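{- Let $G$ be a (finite, simple) plane graph with minimum degree five having no vertices of degree $7$ and no vertices of degree $8$. Then $G$ contains at least one of the following minor $5$-stars: a $\langle 5,6,6,5,\infty\rangle$-star, a $\langle 5,6,6,6,17\rangle$-star, a $\langle 6,6,6,6,11\rangle$-star, a $\langle 5,6,9,5,10\rangle$-star, a $\langle 5,6,11,5,9\rangle$-star, a $\langle 5,5,10,5,12\rangle$-star, a $\langle 5,5,9,5,17\rangle$-star.
   Context: A plane graph is a graph embedded in the plane without edge crossings; $\deg(v)$ denotes the degree of $v$ in $G$. For integers (or $\infty$) $\kappa_1,\dots,\kappa_5$, a $\langle \kappa_1,\kappa_2,\kappa_3,\kappa_4,\kappa_5\rangle$-star in $G$ is a vertex $v$ of degree exactly $5$ together with its five neighbors $v_1,\dots,v_5$, listed in the cyclic order around $v$ given by the embedding (starting at some neighbor, in either orientation), such that $\deg(v_i)\le \kappa_i$ for $i=1,\dots,5$; the entry $\infty$ means no restriction. A minor $5$-star is a $5$-vertex together with its five neighbors. -}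

module Defs where

open import Data.Nat using (ℕ; zero; suc; _+_; _*_; _≤_)
open import Data.Bool using (Bool; true; false; _∧_; _∨_; not; if_then_else_)
open import Data.Fin using (Fin; toℕ)
open import Data.Fin.Properties using () renaming (_≟_ to _≟ᶠ_)
open import Data.List using (List; []; _∷_; length; concatMap; map; filter)
open import Data.Bool.ListAction using (any; all)
open import Data.List.Membership.Propositional using (_∈_)
open import Data.List.Relation.Unary.Unique.Propositional using (Unique)
open import Data.List.Relation.Unary.Any using (Any)
open import Data.Maybe using (Maybe; just; nothing)
open import Data.Product using (Σ; _×_; _,_; ∃)
open import Data.Vec using (Vec; allFin; toList)
open import Relation.Nullary using (¬_)
open import Relation.Nullary.Decidable using (⌊_⌋)
open import Relation.Binary.PropositionalEquality using (_≡_)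
import Data.Nat as N

-- Combinatorial description of a plane graph (rotation system).
-- Vertices are Fin n.  rot v lists the neighbours of v in the cyclic
-- (clockwise) order given by the embedding.  A rotation system
-- describes an embedding in the plane (sphere) iff Euler's formula
-- V - E + F = 2C holds, where F counts the facial walks (orbits of
-- the face-tracing permutation on darts, plus one face per isolated
-- vertex) and C is the number of connected components.

vertices : (n : ℕ) → List (Fin n)
vertices n = toList (allFin n)

eqᶠ : ∀ {n} → Fin n → Fin n → Bool
eqᶠ a b = ⌊ a ≟ᶠ b ⌋

elem : ∀ {n} → Fin n → List (Fin n) → Bool
elem a xs = any (eqᶠ a) xs

-- cyclic successor of x in the list; head is the successor of the last
-- element.  (Returns x if x does not occur.)
nextIn : ∀ {n} → List (Fin n) → Fin n → Fin n
nextIn {n} [] x = x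
nextIn {n} (h ∷ t) x = go (h ∷ t) x
  where
  go : List (Fin n) → Fin n → Fin n
  go [] y = y
  go (a ∷ []) y = if eqᶠ a y then h else y
  go (a ∷ b ∷ r) y = if eqᶠ a y then b else go (b ∷ r) y

Dart : ℕ → Set
Dart n = Fin n × Fin n

module Rotation {n : ℕ} (rot : Fin n → List (Fin n)) where

  deg : Fin n → ℕ
  deg v = length (rot v)

  darts : List (Dart n)
  darts = concatMap (λ v → map (λ u → (v , u)) (rot v)) (vertices n)

  -- face-tracing permutation: dart (v,u) ↦ (u, successor of v around u)
  φ : Dart n → Dart n
  φ (v , u) = (u , nextIn (rot u) v)

  iter : ℕ → Dart n → Dart n
  iter zero d = d
  iter (suc k) d = φ (iter k d)

  key : Dart n → ℕ
  key (v , u) = toℕ v * n + toℕ u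

  _≤ᵇ_ : ℕ → ℕ → Bool
  a ≤ᵇ b = ⌊ a N.≤? b ⌋

  orbitMin : Dart n → Bool
  orbitMin d = go (length darts)
    where
    go : ℕ → Bool
    go zero = true
    go (suc k) = (key d ≤ᵇ key (iter (suc k) d)) ∧ go k

  isolated : Fin n → Bool
  isolated v = ⌊ deg v N.≟ 0 ⌋

  numFaces : ℕ
  numFaces = length (filter (λ d → orbitMin d ≟b true) darts)
           + length (filter (λ v → isolated v ≟b true) (vertices n))
    where
    open import Data.Bool.Properties using () renaming (_≟_ to _≟b_)

  reach : ℕ → Fin n → Fin n → Bool
  reach zero v u = eqᶠ v u
  reach (suc k) v u = reach k v u ∨ any (reach k v) (rot u)

  compRep : Fin n → Bool
  compRep v = all (λ u → not (reach n v u) ∨ (toℕ v ≤ᵇ toℕ u)) (vertices n)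

  numComponents : ℕ
  numComponents = length (filter (λ v → compRep v ≟b true) (vertices n))
    where
    open import Data.Bool.Properties using () renaming (_≟_ to _≟b_)

record PlaneGraph (n : ℕ) : Set where
  field
    rot       : Fin n → List (Fin n)
    noDup     : ∀ v → Unique (rot v)
    noLoop    : ∀ v → ¬ (v ∈ rot v)
    symmetric : ∀ u v → u ∈ rot v → v ∈ rot u
  open Rotation rot public
  field
    -- Euler's formula, multiplied by 2:  2V - 2E + 2F = 4C, with 2E = #darts
    euler : 2 * n + 2 * numFaces ≡ 4 * numComponents + length darts

-- Stars.  Bounds in Maybe ℕ, `nothing` = ∞ (no restriction).

Bound : Set
Bound = Maybe ℕ

_≤∞_ : ℕ → Bound → Set
d ≤∞ nothing = Data.Unit.⊤ where import Data.Unit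
d ≤∞ just k = d ≤ k

dihedral5 : {A : Set} → A → A → A → A → A → List (A × A × A × A × A)
dihedral5 a b c d e =
    (a , b , c , d , e) ∷ (b , c , d , e , a) ∷ (c , d , e , a , b)
  ∷ (d , e , a , b , c) ∷ (e , a , b , c , d)
  ∷ (a , e , d , c , b) ∷ (e , d , c , b , a) ∷ (d , c , b , a , e)
  ∷ (c , b , a , e , d) ∷ (b , a , e , d , c) ∷ []

HasStar : ∀ {n} → PlaneGraph n → Bound → Bound → Bound → Bound → Bound → Set
HasStar {n} G k1 k2 k3 k4 k5 =
  Σ (Fin n) λ v → Σ (Fin n) λ a → Σ (Fin n) λ b → Σ (Fin n) λ c →
  Σ (Fin n) λ d → Σ (Fin n) λ e →
    (rot v ≡ a ∷ b ∷ c ∷ d ∷ e ∷ []) ×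
    Any (λ { (v1 , v2 , v3 , v4 , v5) →
             (deg v1 ≤∞ k1) × (deg v2 ≤∞ k2) × (deg v3 ≤∞ k3)
           × (deg v4 ≤∞ k4) × (deg v5 ≤∞ k5) })
        (dihedral5 a b c d e)
  where open PlaneGraph G

{-# OPTIONS --safe #-}
module Submission where

-- Discharging, in units of 1/60.  A vertex v starts with 60 (deg v − 6) and receives 30 at every corner that lies in
-- a non-triangular face; by Euler's formula the total is negative.  Each neighbour z of degree at least 9 of a
-- 5-vertex q sends q an amount depending on deg z and on the other four neighbours of q.  If no star of the list
-- occurs, every 5-vertex ends up nonnegative: a finite check over degree classes.  On the other side z can afford
-- about 60 (deg z − 6) / deg z per neighbour, and more next to a neighbour of degree at least 6, whose share is free.
-- The rules overdraw only z of degree 11 and 13, when all neighbours of z are 5-vertices.  Without a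
-- ⟨5,6,6,5,∞⟩-star each of them has a major vertex among the two neighbours opposite to z; as deg z is odd, these
-- opposite vertices cannot alternate between major and minor, so some neighbour of z needs little or nothing from z.

-- The unit 1/60 makes the even shares at degrees 9, 10, 12 and 18, namely 20, 24, 30 and 40, whole
-- numbers. Degrees 11 and 13 are billed at the rates 30 and 33 per neighbour, which exceed their
-- capital 300 and 420 by 30 and by 9. Some 5-vertices even need 36 there, and the excess over the
-- rate is moved to a 5-vertex next to them around z. Next to 11 this 5-vertex shares with them an
-- opposite vertex of degree 10, and without a star it needs at most 24. Next to 13-17 it shares
-- with them an opposite 5-vertex m, and it needs at most 30 unless its other opposite vertex has
-- degree 10. In that case m lies between two 10-vertices and is rich enough to pay: this is the
-- purpose of `aid`. All charges depend only on degree classes and on whether the faces at the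
-- 5-vertex are triangles, so every local inequality is a finite computation; the geometry serves
-- only to identify the vertices that occur in consecutive local inequalities.

open import Defs
open import Data.Bool using (Bool; true; false; _∧_; _∨_; not; if_then_else_; T)
open import Data.Bool.ListAction using (all; any)
open import Data.Bool.Properties using (¬-not)
import Data.Bool.Properties as Bool
open import Data.Empty using (⊥; ⊥-elim)
open import Data.Fin using (Fin; zero; suc; toℕ; combine)
open import Data.Fin.Properties using (pigeonhole; toℕ-combine; combine-injective; toℕ-injective; toℕ<n) renaming (_≟_ to _≟ᶠ_)
import Data.Fin.Properties as Fin
open import Data.List using (List; []; _∷_; _++_; length; map; filter; concatMap; lookup)
open import Data.List.Membership.Propositional using (_∈_; _∉_; find)
open import Data.List.Membership.Propositional.Properties using (∈-∃++; ∈-map⁺; ∈-concatMap⁺)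
open import Data.List.Properties using (∷-injective)
open import Data.List.Relation.Binary.Permutation.Propositional as Perm using (_↭_; ↭⇒↭ₛ)
open import Data.List.Relation.Binary.Permutation.Propositional.Properties using (++-comm; ∈-resp-↭; ↭-length)
import Data.List.Relation.Binary.Permutation.Setoid.Properties as PermSetoid
open import Data.List.Relation.Unary.All as All using (All; []; _∷_)
open import Data.List.Relation.Unary.All.Properties using (¬Any⇒All¬)
open import Data.List.Relation.Unary.AllPairs using ([]; _∷_)
open import Data.List.Relation.Unary.Any as Any using (Any; here; there; any?)
open import Data.List.Relation.Unary.Any.Properties using (lookup-index)
open import Data.List.Relation.Unary.Unique.Propositional using (Unique)
open import Data.Maybe using (just; nothing)
open import Data.Nat using (ℕ; zero; suc; _+_; _*_; _∸_; _≤_; _<_; z≤n; s≤s; _≤?_; _<?_; _≟_; _≤ᵇ_; _≡ᵇ_)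
open import Data.Nat.Properties hiding (_≤?_; _<?_; _≟_)
open import Data.Nat.Tactic.RingSolver using (solve-∀)
open import Data.Product using (Σ; ∃; _×_; _,_; proj₁; proj₂)
open import Data.Sum using (_⊎_; inj₁; inj₂)
open import Data.Unit using (⊤; tt)
open import Data.Vec using (allFin; tabulate; toList)
open import Data.Vec.Membership.Propositional.Properties using (∈-allFin⁺; ∈-toList⁺)
open import Data.Vec.Properties using (length-toList)
open import Function using (_∘_; id)
open import Relation.Binary.PropositionalEquality as ≡ using (_≡_; _≢_; refl; sym; trans; cong; cong₂; subst; subst₂; module ≡-Reasoning)
open import Relation.Nullary using (¬_; Dec; yes; no)
open import Relation.Nullary.Decidable using (⌊_⌋; map′; _×-dec_; _⊎-dec_; decidable-stable)

-- Sums over lists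

private variable
  A B : Set
  f g : A → ℕ

⟦_⟧ : Bool → ℕ
⟦ true ⟧ = 1
⟦ false ⟧ = 0

∑ : List A → (A → ℕ) → ℕ
∑ [] f = 0
∑ (x ∷ xs) f = f x + ∑ xs f

∑-mono : ∀ (xs : List A) → (∀ {x} → x ∈ xs → f x ≤ g x) → ∑ xs f ≤ ∑ xs g
∑-mono [] h = z≤n
∑-mono (x ∷ xs) h = +-mono-≤ (h (here refl)) (∑-mono xs (h ∘ there))

∑-cong : ∀ (xs : List A) → (∀ {x} → x ∈ xs → f x ≡ g x) → ∑ xs f ≡ ∑ xs g
∑-cong [] h = refl
∑-cong (x ∷ xs) h = cong₂ _+_ (h (here refl)) (∑-cong xs (h ∘ there))

∑-+ : ∀ (xs : List A) (f g : A → ℕ) → ∑ xs (λ x → f x + g x) ≡ ∑ xs f + ∑ xs g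
∑-+ [] f g = refl
∑-+ (x ∷ xs) f g rewrite ∑-+ xs f g = interchange (f x) (g x) (∑ xs f) (∑ xs g)
  where
  interchange : ∀ a b c d → a + b + (c + d) ≡ a + c + (b + d)
  interchange = solve-∀

∑-* : ∀ (xs : List A) (k : ℕ) (f : A → ℕ) → ∑ xs (λ x → k * f x) ≡ k * ∑ xs f
∑-* [] k f = sym (*-zeroʳ k)
∑-* (x ∷ xs) k f rewrite ∑-* xs k f = sym (*-distribˡ-+ k (f x) (∑ xs f))

∑-const : ∀ (xs : List A) k → ∑ xs (λ _ → k) ≡ k * length xs
∑-const [] k = sym (*-zeroʳ k)
∑-const (x ∷ xs) k rewrite ∑-const xs k = sym (*-suc k (length xs))

∑-swap : ∀ (xs : List A) (ys : List B) (f : A → B → ℕ) →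
  ∑ xs (λ x → ∑ ys (f x)) ≡ ∑ ys (λ y → ∑ xs (λ x → f x y))
∑-swap [] ys f = sym (∑-const ys 0)
∑-swap (x ∷ xs) ys f rewrite ∑-swap xs ys f = sym (∑-+ ys (f x) (λ y → ∑ xs (λ x → f x y)))

∑-++ : ∀ (xs ys : List A) (f : A → ℕ) → ∑ (xs ++ ys) f ≡ ∑ xs f + ∑ ys f
∑-++ [] ys f = refl
∑-++ (x ∷ xs) ys f rewrite ∑-++ xs ys f = sym (+-assoc (f x) (∑ xs f) (∑ ys f))

∑-map : ∀ (h : A → B) xs (f : B → ℕ) → ∑ (map h xs) f ≡ ∑ xs (f ∘ h)
∑-map h [] f = refl
∑-map h (x ∷ xs) f = cong (f (h x) +_) (∑-map h xs f)

∑-concatMap : ∀ (h : A → List B) xs (f : B → ℕ) → ∑ (concatMap h xs) f ≡ ∑ xs (λ x → ∑ (h x) f)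
∑-concatMap h [] f = refl
∑-concatMap h (x ∷ xs) f =
  trans (∑-++ (h x) (concatMap h xs) f) (cong (∑ (h x) f +_) (∑-concatMap h xs f))

∑-↭ : ∀ {xs ys : List A} (f : A → ℕ) → xs ↭ ys → ∑ xs f ≡ ∑ ys f
∑-↭ f Perm.refl = refl
∑-↭ f (Perm.prep x p) = cong (f x +_) (∑-↭ f p)
∑-↭ {ys = _ ∷ _ ∷ ys} f (Perm.swap x y p) rewrite ∑-↭ f p = exchange (f x) (f y) (∑ ys f)
  where
  exchange : ∀ a b c → a + (b + c) ≡ b + (a + c)
  exchange = solve-∀
∑-↭ f (Perm.trans p q) = trans (∑-↭ f p) (∑-↭ f q)

term≤∑ : ∀ {x} {xs : List A} (f : A → ℕ) → x ∈ xs → f x ≤ ∑ xs f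
term≤∑ {xs = y ∷ xs} f (here refl) = m≤m+n (f y) (∑ xs f)
term≤∑ {xs = y ∷ xs} f (there p) = ≤-trans (term≤∑ f p) (m≤n+m (∑ xs f) (f y))

two-terms≤∑ : ∀ {x y} {xs : List A} (f : A → ℕ) → x ∈ xs → y ∈ xs → x ≢ y → f x + f y ≤ ∑ xs f
two-terms≤∑ f (here refl) (here refl) x≢y = ⊥-elim (x≢y refl)
two-terms≤∑ f (here refl) (there q) _ = +-monoʳ-≤ _ (term≤∑ f q)
two-terms≤∑ {xs = z ∷ xs} f (there p) (here refl) _ =
  subst (_≤ ∑ (z ∷ xs) f) (+-comm (f z) _) (+-monoʳ-≤ (f z) (term≤∑ f p))
two-terms≤∑ {xs = z ∷ xs} f (there p) (there q) x≢y =
  ≤-trans (two-terms≤∑ f p q x≢y) (m≤n+m (∑ xs f) (f z))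

length-filter : ∀ (p : A → Bool) xs → length (filter (λ x → p x Bool.≟ true) xs) ≡ ∑ xs (⟦_⟧ ∘ p)
length-filter p [] = refl
length-filter p (x ∷ xs) with p x
... | true = cong suc (length-filter p xs)
... | false = length-filter p xs

length-∑ : ∀ (xs : List A) → length xs ≡ ∑ xs (λ _ → 1)
length-∑ xs = sym (trans (∑-const xs 1) (+-identityʳ _))

eqᶠ-refl : ∀ {n} (a : Fin n) → eqᶠ a a ≡ true
eqᶠ-refl a with a ≟ᶠ a
... | yes _ = refl
... | no a≢a = ⊥-elim (a≢a refl)

eqᶠ-≢ : ∀ {n} {a b : Fin n} → a ≢ b → eqᶠ a b ≡ false
eqᶠ-≢ {a = a} {b} a≢b with a ≟ᶠ b
... | yes a≡b = ⊥-elim (a≢b a≡b)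
... | no _ = refl

eqᶠ⇒≡ : ∀ {n} {a b : Fin n} → eqᶠ a b ≡ true → a ≡ b
eqᶠ⇒≡ {a = a} {b} h with a ≟ᶠ b
... | yes a≡b = a≡b

eqᶠ-suc : ∀ {n} (a b : Fin n) → eqᶠ (suc a) (suc b) ≡ eqᶠ a b
eqᶠ-suc a b with a ≟ᶠ b
... | yes _ = refl
... | no _ = refl

count : ∀ {n} → Fin n → List (Fin n) → ℕ
count u xs = ∑ xs (λ x → ⟦ eqᶠ u x ⟧)

∑-tabulate : ∀ {n} {C : Set} (e : Fin n → A) (h : A → C) (f : C → ℕ) →
  ∑ (toList (tabulate (h ∘ e))) f ≡ ∑ (toList (tabulate e)) (f ∘ h)
∑-tabulate {n = zero} e h f = refl
∑-tabulate {n = suc n} e h f = cong (f (h (e zero)) +_) (∑-tabulate (e ∘ suc) h f)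

∑-vertices-suc : ∀ n (f : Fin (suc n) → ℕ) → ∑ (toList (tabulate {n = n} suc)) f ≡ ∑ (vertices n) (f ∘ suc)
∑-vertices-suc n f = ∑-tabulate {n = n} id suc f

∑-δ : ∀ {n} (x : Fin n) (f : Fin n → ℕ) → ∑ (vertices n) (λ u → ⟦ eqᶠ u x ⟧ * f u) ≡ f x
∑-δ {suc n} zero f = begin
    f zero + 0 + ∑ (toList (tabulate suc)) (λ u → ⟦ eqᶠ u zero ⟧ * f u)
      ≡⟨ cong (f zero + 0 +_) (∑-vertices-suc n (λ u → ⟦ eqᶠ u zero ⟧ * f u)) ⟩
    f zero + 0 + ∑ (vertices n) (λ _ → 0)
      ≡⟨ cong₂ _+_ (+-identityʳ (f zero)) (∑-const (vertices n) 0) ⟩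
    f zero + 0
      ≡⟨ +-identityʳ _ ⟩
    f zero ∎
  where open ≡-Reasoning
∑-δ {suc n} (suc x) f = begin
    ∑ (toList (tabulate suc)) (λ u → ⟦ eqᶠ u (suc x) ⟧ * f u)
      ≡⟨ ∑-vertices-suc n (λ u → ⟦ eqᶠ u (suc x) ⟧ * f u) ⟩
    ∑ (vertices n) (λ u → ⟦ eqᶠ (suc u) (suc x) ⟧ * f (suc u))
      ≡⟨ ∑-cong (vertices n) (λ {u} _ → cong (λ b → ⟦ b ⟧ * f (suc u)) (eqᶠ-suc u x)) ⟩
    ∑ (vertices n) (λ u → ⟦ eqᶠ u x ⟧ * f (suc u))
      ≡⟨ ∑-δ x (f ∘ suc) ⟩
    f (suc x) ∎
  where open ≡-Reasoning

-- Multiplicities turn a sum over one neighbourhood into a sum over all vertices, so that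
-- `handshake` can exchange the order of summation.
∑-count : ∀ {n} (xs : List (Fin n)) (f : Fin n → ℕ) →
  ∑ xs f ≡ ∑ (vertices n) (λ u → count u xs * f u)
∑-count {n} xs f = begin
    ∑ xs f
      ≡⟨ ∑-cong xs (λ {x} _ → sym (∑-δ x f)) ⟩
    ∑ xs (λ x → ∑ (vertices n) (λ u → ⟦ eqᶠ u x ⟧ * f u))
      ≡⟨ ∑-swap xs (vertices n) _ ⟩
    ∑ (vertices n) (λ u → ∑ xs (λ x → ⟦ eqᶠ u x ⟧ * f u))
      ≡⟨ ∑-cong (vertices n) (λ {u} _ → factor u) ⟩
    ∑ (vertices n) (λ u → count u xs * f u) ∎
  where
  open ≡-Reasoning
  factor : ∀ u → ∑ xs (λ x → ⟦ eqᶠ u x ⟧ * f u) ≡ count u xs * f u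
  factor u = trans (∑-cong xs (λ {x} _ → *-comm ⟦ eqᶠ u x ⟧ (f u)))
    (trans (∑-* xs (f u) _) (*-comm (f u) _))

count-∉ : ∀ {n} {u : Fin n} {xs} → u ∉ xs → count u xs ≡ 0
count-∉ {xs = []} _ = refl
count-∉ {xs = x ∷ xs} u∉ rewrite eqᶠ-≢ (u∉ ∘ here) = count-∉ (u∉ ∘ there)

count-∈ : ∀ {n} {u : Fin n} {xs} → Unique xs → u ∈ xs → count u xs ≡ 1
count-∈ {u = u} (x≢ ∷ _) (here refl) rewrite eqᶠ-refl u =
  cong suc (count-∉ (λ p → All.lookup x≢ p refl))
count-∈ (x≢ ∷ uniq) (there p) rewrite eqᶠ-≢ (All.lookup x≢ p ∘ sym) = count-∈ uniq p

∈-vertices : ∀ {n} (x : Fin n) → x ∈ vertices n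
∈-vertices x = ∈-toList⁺ (∈-allFin⁺ x)

-- The cyclic successor

mutual
  -- The loop local to nextIn, which has no name of its own; the mutual block lets unification identify it.
  nextFrom : ∀ {n} → Fin n → List (Fin n) → Fin n → List (Fin n) → Fin n
  nextFrom h t x xs = _

  nextIn-unfold : ∀ {n} (h : Fin n) t x → nextIn (h ∷ t) x ≡ nextFrom h t x (h ∷ t)
  nextIn-unfold h t x with h ∷ t
  ... | xs = refl

-- The loop recurses on a suffix while the mapped function must stay fixed; hence an arbitrary `s`
-- that agrees with the loop on the current suffix.
map-nextFrom : ∀ {n} (h : Fin n) t (s : Fin n → Fin n) x xs → Unique (x ∷ xs) →
  (∀ {y} → y ∈ x ∷ xs → s y ≡ nextFrom h t y (x ∷ xs)) → map s (x ∷ xs) ≡ xs ++ h ∷ []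
map-nextFrom h t s x [] _ eq rewrite eq (here refl) | eqᶠ-refl x = refl
map-nextFrom h t s x (y ∷ xs) (x≢ ∷ uniq) eq = cong₂ _∷_ first (map-nextFrom h t s y xs uniq rest)
  where
  first : s x ≡ y
  first rewrite eq (here refl) | eqᶠ-refl x = refl
  rest : ∀ {z} → z ∈ y ∷ xs → s z ≡ nextFrom h t z (y ∷ xs)
  rest {z} p = trans (eq (there p)) (cong (λ b → if b then y else nextFrom h t z (y ∷ xs)) (eqᶠ-≢ (All.lookup x≢ p)))

map-nextIn : ∀ {n} (h : Fin n) t → Unique (h ∷ t) → map (nextIn (h ∷ t)) (h ∷ t) ≡ t ++ h ∷ []
map-nextIn h t uniq = map-nextFrom h t (nextIn (h ∷ t)) h t uniq (λ {y} _ → nextIn-unfold h t y)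

Unique-↭ : ∀ {xs ys : List A} → xs ↭ ys → Unique xs → Unique ys
Unique-↭ {A = A} p = PermSetoid.Unique-resp-↭ (≡.setoid A) (↭⇒↭ₛ p)

∑-next : ∀ {n} {xs : List (Fin n)} → Unique xs → (f : Fin n → ℕ) → ∑ xs (f ∘ nextIn xs) ≡ ∑ xs f
∑-next {xs = []} _ f = refl
∑-next {xs = h ∷ t} uniq f = trans (sym (∑-map (nextIn (h ∷ t)) (h ∷ t) f))
  (trans (cong (λ ys → ∑ ys f) (map-nextIn h t uniq)) (∑-↭ f (++-comm t (h ∷ []))))

Unique-map-injective : ∀ {s : A → B} {xs} → Unique (map s xs) → ∀ {x y} → x ∈ xs → y ∈ xs → s x ≡ s y → x ≡ y
Unique-map-injective _ (here refl) (here refl) _ = refl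
Unique-map-injective {s = s} (x≢ ∷ _) (here refl) (there q) eq =
  ⊥-elim (All.lookup x≢ (∈-map⁺ s q) eq)
Unique-map-injective {s = s} (x≢ ∷ _) (there p) (here refl) eq =
  ⊥-elim (All.lookup x≢ (∈-map⁺ s p) (sym eq))
Unique-map-injective (_ ∷ uniq) (there p) (there q) eq = Unique-map-injective uniq p q eq

nextIn-injective : ∀ {n} {xs : List (Fin n)} → Unique xs → ∀ {x y} → x ∈ xs → y ∈ xs →
  nextIn xs x ≡ nextIn xs y → x ≡ y
nextIn-injective {xs = h ∷ t} uniq = Unique-map-injective
  (subst Unique (sym (map-nextIn h t uniq)) (Unique-↭ (++-comm (h ∷ []) t) uniq))

-- Chain s xs e: s leads from each entry of xs to the following one, and from the last entry to e.
Chain : ∀ {A : Set} → (A → A) → List A → A → Set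
Chain s [] e = ⊤
Chain s (x ∷ []) e = s x ≡ e
Chain s (x ∷ y ∷ xs) e = s x ≡ y × Chain s (y ∷ xs) e

map⇒Chain : ∀ (s : A → A) x xs {e} → map s (x ∷ xs) ≡ xs ++ e ∷ [] → Chain s (x ∷ xs) e
map⇒Chain s x [] refl = refl
map⇒Chain s x (y ∷ xs) eq = proj₁ (∷-injective eq) , map⇒Chain s y xs (proj₂ (∷-injective eq))

Chain-split : ∀ (s : A → A) xs {y ys e} → Chain s (xs ++ y ∷ ys) e → Chain s xs y × Chain s (y ∷ ys) e
Chain-split s [] c = tt , c
Chain-split s (x ∷ []) (eq , c) = eq , c
Chain-split s (x ∷ x′ ∷ xs) (eq , c) = (eq , proj₁ (Chain-split s (x′ ∷ xs) c)) , proj₂ (Chain-split s (x′ ∷ xs) c)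

Chain-join : ∀ (s : A → A) xs {y ys e} → Chain s xs y → Chain s (y ∷ ys) e → Chain s (xs ++ y ∷ ys) e
Chain-join s [] _ c = c
Chain-join s (x ∷ []) eq c = eq , c
Chain-join s (x ∷ x′ ∷ xs) (eq , c) c′ = eq , Chain-join s (x′ ∷ xs) c c′

-- With `p` in front, its successors are the next entries, and their distinctness from `p` can be
-- read off `Unique`.
rotateTo : ∀ {n} {xs : List (Fin n)} → Unique xs → ∀ {p} → p ∈ xs →
  ∃ λ ys → (xs ↭ p ∷ ys) × Chain (nextIn xs) (p ∷ ys) p
rotateTo {xs = h ∷ t} uniq p∈ with map⇒Chain (nextIn (h ∷ t)) h t (map-nextIn h t uniq) | ∈-∃++ p∈
... | chain | [] , bs , refl = bs , Perm.refl , chain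
... | chain | a ∷ as , bs , refl = bs ++ a ∷ as , ++-comm (a ∷ as) (_ ∷ bs) ,
      Chain-join _ (_ ∷ bs) (proj₂ halves) (proj₁ halves)
  where halves = Chain-split (nextIn (h ∷ t)) (a ∷ as) chain

nextIn-∈ : ∀ {n} {xs : List (Fin n)} → Unique xs → ∀ {x} → x ∈ xs → nextIn xs x ∈ xs
nextIn-∈ {xs = h ∷ t} uniq x∈ = ∈-resp-↭ (++-comm t (h ∷ []))
  (subst (nextIn (h ∷ t) _ ∈_) (map-nextIn h t uniq) (∈-map⁺ (nextIn (h ∷ t)) x∈))

module _ {n} {xs : List (Fin n)} (uniq : Unique xs) {p : Fin n} (p∈ : p ∈ xs) where
  private s = nextIn xs

  nextIn≢ : 2 ≤ length xs → s p ≢ p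
  nextIn≢ 2≤ with rotateTo uniq p∈
  ... | [] , perm , _ with s≤s () ← subst (2 ≤_) (↭-length perm) 2≤
  ... | y ∷ _ , perm , sp≡y , _ with (p≢y ∷ _) ∷ _ ← Unique-↭ perm uniq =
    λ sp≡p → p≢y (trans (sym sp≡p) sp≡y)

  nextIn²≢ : 3 ≤ length xs → s (s p) ≢ p
  nextIn²≢ 3≤ with rotateTo uniq p∈
  ... | [] , perm , _ with s≤s () ← subst (3 ≤_) (↭-length perm) 3≤
  nextIn²≢ 3≤ | _ ∷ [] , perm , _ with s≤s (s≤s ()) ← subst (3 ≤_) (↭-length perm) 3≤
  nextIn²≢ 3≤ | _ ∷ y ∷ _ , perm , refl , s²p≡y , _ with (_ ∷ p≢y ∷ _) ∷ _ ← Unique-↭ perm uniq =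
    λ s²p≡p → p≢y (trans (sym s²p≡p) s²p≡y)

  nextIn³≢ : 4 ≤ length xs → s (s (s p)) ≢ p
  nextIn³≢ 4≤ with rotateTo uniq p∈
  ... | [] , perm , _ with s≤s () ← subst (4 ≤_) (↭-length perm) 4≤
  nextIn³≢ 4≤ | _ ∷ [] , perm , _ with s≤s (s≤s ()) ← subst (4 ≤_) (↭-length perm) 4≤
  nextIn³≢ 4≤ | _ ∷ _ ∷ [] , perm , _ with s≤s (s≤s (s≤s ())) ← subst (4 ≤_) (↭-length perm) 4≤
  nextIn³≢ 4≤ | _ ∷ _ ∷ y ∷ _ , perm , refl , refl , s³p≡y , _ with (_ ∷ _ ∷ p≢y ∷ _) ∷ _ ← Unique-↭ perm uniq =
    λ s³p≡p → p≢y (trans (sym s³p≡p) s³p≡y)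

-- The pointwise bound makes the truncated differences exact; a gap at single entries then survives
-- in the sum.
∑-slack : ∀ (xs : List A) → (∀ {x} → x ∈ xs → f x ≤ g x) → ∑ xs f + ∑ xs (λ x → g x ∸ f x) ≡ ∑ xs g
∑-slack {f = f} {g} xs h = trans (sym (∑-+ xs f (λ x → g x ∸ f x))) (∑-cong xs (λ x∈ → m+[n∸m]≡n (h x∈)))

∑-gain : ∀ {xs : List A} {x} c → (∀ {x} → x ∈ xs → f x ≤ g x) → x ∈ xs → c + f x ≤ g x → ∑ xs f + c ≤ ∑ xs g
∑-gain {f = f} {g} {xs} {x} c h x∈ gap = subst (∑ xs f + c ≤_) (∑-slack xs h)
  (+-monoʳ-≤ (∑ xs f) (≤-trans (m+n≤o⇒m≤o∸n c gap) (term≤∑ (λ x → g x ∸ f x) x∈)))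

∑-gain₂ : ∀ {xs : List A} {x y} c → (∀ {x} → x ∈ xs → f x ≤ g x) → x ∈ xs → y ∈ xs → x ≢ y →
  c + f x ≤ g x → c + f y ≤ g y → ∑ xs f + (c + c) ≤ ∑ xs g
∑-gain₂ {f = f} {g} {xs} {x} {y} c h x∈ y∈ x≢y gap gap′ = subst (∑ xs f + (c + c) ≤_) (∑-slack xs h)
  (+-monoʳ-≤ (∑ xs f) (≤-trans (+-mono-≤ (m+n≤o⇒m≤o∸n c gap) (m+n≤o⇒m≤o∸n c gap′))
    (two-terms≤∑ (λ x → g x ∸ f x) x∈ y∈ x≢y)))

mutual
  -- The loop local to orbitMin, identified in the same way.
  minUpTo : ∀ {n} (rot : Fin n → List (Fin n)) → Dart n → ℕ → Bool
  minUpTo rot d k = _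

  orbitMin-unfold : ∀ {n} (rot : Fin n → List (Fin n)) d →
    Rotation.orbitMin rot d ≡ minUpTo rot d (length (Rotation.darts rot))
  orbitMin-unfold rot d with length (Rotation.darts rot)
  ... | k = refl

-- Euler's formula

isYes⇒ : ∀ {P : Set} (P? : Dec P) → ⌊ P? ⌋ ≡ true → P
isYes⇒ (yes p) _ = p

∧-true : ∀ {a b} → a ∧ b ≡ true → a ≡ true × b ≡ true
∧-true {true} {true} _ = refl , refl

all-true : ∀ {A : Set} (p : A → Bool) (xs : List A) → (∀ x → p x ≡ true) → all p xs ≡ true
all-true p [] h = refl
all-true p (x ∷ xs) h rewrite h x = all-true p xs h

∑-vertices≥1 : ∀ {n} (p : Fin n → Bool) v → p v ≡ true → 1 ≤ ∑ (vertices n) (⟦_⟧ ∘ p)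
∑-vertices≥1 p v pv = subst (_≤ _) (cong ⟦_⟧ pv) (term≤∑ (⟦_⟧ ∘ p) (∈-vertices v))

atMostOne₃ : ∀ a b c → ¬ (a ≡ true × b ≡ true) → ¬ (a ≡ true × c ≡ true) → ¬ (b ≡ true × c ≡ true) →
  ⟦ a ⟧ + (⟦ b ⟧ + ⟦ c ⟧) ≤ 1
atMostOne₃ true true _ p _ _ = ⊥-elim (p (refl , refl))
atMostOne₃ true false true _ q _ = ⊥-elim (q (refl , refl))
atMostOne₃ true false false _ _ _ = s≤s z≤n
atMostOne₃ false true true _ _ r = ⊥-elim (r (refl , refl))
atMostOne₃ false true false _ _ _ = s≤s z≤n
atMostOne₃ false false true _ _ _ = s≤s z≤n
atMostOne₃ false false false _ _ _ = z≤n

atMostOne₄ : ∀ a b c d → ¬ (a ≡ true × b ≡ true) → ¬ (a ≡ true × c ≡ true) → ¬ (a ≡ true × d ≡ true) →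
  ¬ (b ≡ true × c ≡ true) → ¬ (b ≡ true × d ≡ true) → ¬ (c ≡ true × d ≡ true) →
  ⟦ a ⟧ + (⟦ b ⟧ + (⟦ c ⟧ + ⟦ d ⟧)) ≤ 1
atMostOne₄ false b c d _ _ _ bc bd cd = atMostOne₃ b c d bc bd cd
atMostOne₄ true true _ _ ab _ _ _ _ _ = ⊥-elim (ab (refl , refl))
atMostOne₄ true false true _ _ ac _ _ _ _ = ⊥-elim (ac (refl , refl))
atMostOne₄ true false false true _ _ ad _ _ _ = ⊥-elim (ad (refl , refl))
atMostOne₄ true false false false _ _ _ _ _ _ = s≤s z≤n

module Euler {n : ℕ} (G : PlaneGraph (suc n)) (5≤deg : ∀ v → 5 ≤ PlaneGraph.deg G v) where
  open PlaneGraph G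

  private
    V = vertices (suc n)

  nx : Fin (suc n) → Fin (suc n) → Fin (suc n)
  nx u = nextIn (rot u)

  count-sym : ∀ u v → count u (rot v) ≡ count v (rot u)
  count-sym u v with any? (u ≟ᶠ_) (rot v)
  ... | yes u∈ = trans (count-∈ (noDup v) u∈) (sym (count-∈ (noDup u) (symmetric u v u∈)))
  ... | no u∉ = trans (count-∉ u∉) (sym (count-∉ (u∉ ∘ symmetric v u)))

  -- Double counting of darts: the lists are duplicate-free and adjacency is symmetric, so `u`
  -- occurs in `rot v` as often as `v` in `rot u`.
  handshake : ∀ (f : Fin (suc n) → Fin (suc n) → ℕ) →
    ∑ V (λ v → ∑ (rot v) (f v)) ≡ ∑ V (λ v → ∑ (rot v) (λ u → f u v))
  handshake f = begin
      ∑ V (λ v → ∑ (rot v) (f v))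
        ≡⟨ ∑-cong V (λ {v} _ → ∑-count (rot v) (f v)) ⟩
      ∑ V (λ v → ∑ V (λ u → count u (rot v) * f v u))
        ≡⟨ ∑-swap V V _ ⟩
      ∑ V (λ u → ∑ V (λ v → count u (rot v) * f v u))
        ≡⟨ ∑-cong V (λ {u} _ → ∑-cong V (λ {v} _ → cong (_* f v u) (count-sym u v))) ⟩
      ∑ V (λ u → ∑ V (λ v → count v (rot u) * f v u))
        ≡⟨ ∑-cong V (λ {u} _ → sym (∑-count (rot u) (λ v → f v u))) ⟩
      ∑ V (λ u → ∑ (rot u) (λ v → f v u)) ∎
    where open ≡-Reasoning

  IsDart : Dart (suc n) → Set
  IsDart (v , u) = u ∈ rot v

  ∑D : (Dart (suc n) → ℕ) → ℕ
  ∑D f = ∑ V (λ v → ∑ (rot v) (λ u → f (v , u)))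

  ∑-darts : ∀ f → ∑ darts f ≡ ∑D f
  ∑-darts f = trans (∑-concatMap (λ v → map (v ,_) (rot v)) V f)
    (∑-cong V (λ {v} _ → ∑-map (v ,_) (rot v) f))

  ∑D-mono : ∀ {f g} → (∀ d → IsDart d → f d ≤ g d) → ∑D f ≤ ∑D g
  ∑D-mono h = ∑-mono V (λ {v} _ → ∑-mono (rot v) (h (v , _)))

  ∑D-cong : ∀ {f g} → (∀ d → IsDart d → f d ≡ g d) → ∑D f ≡ ∑D g
  ∑D-cong h = ∑-cong V (λ {v} _ → ∑-cong (rot v) (h (v , _)))

  ∑D-+ : ∀ f g → ∑D (λ d → f d + g d) ≡ ∑D f + ∑D g
  ∑D-+ f g = trans (∑-cong V (λ {v} _ → ∑-+ (rot v) (λ u → f (v , u)) (λ u → g (v , u))))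
    (∑-+ V (λ v → ∑ (rot v) (λ u → f (v , u))) (λ v → ∑ (rot v) (λ u → g (v , u))))

  ∑D-* : ∀ k f → ∑D (λ d → k * f d) ≡ k * ∑D f
  ∑D-* k f = trans (∑-cong V (λ {v} _ → ∑-* (rot v) k _)) (∑-* V k _)

  -- `φ` reverses a dart and then turns it to the next neighbour at its new tail; `handshake` and
  -- `∑-next` handle the two moves.
  ∑D-φ : ∀ f → ∑D (f ∘ φ) ≡ ∑D f
  ∑D-φ f = trans (handshake (λ v u → f (u , nx u v))) (∑-cong V (λ {u} _ → ∑-next (noDup u) (λ w → f (u , w))))

  φ-dart : ∀ d → IsDart d → IsDart (φ d)
  φ-dart (v , u) u∈ = nextIn-∈ (noDup u) (symmetric u v u∈)

  iter-dart : ∀ k d → IsDart d → IsDart (iter k d)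
  iter-dart zero d h = h
  iter-dart (suc k) d h = φ-dart (iter k d) (iter-dart k d h)

  φ-injective : ∀ d d′ → IsDart d → IsDart d′ → φ d ≡ φ d′ → d ≡ d′
  φ-injective (v , u) (v′ , u′) h h′ eq with cong proj₁ eq
  ... | refl = cong (_, u) (nextIn-injective (noDup u) (symmetric u v h) (symmetric u v′ h′) (cong proj₂ eq))

  iter-+ : ∀ a b d → iter (a + b) d ≡ iter a (iter b d)
  iter-+ zero b d = refl
  iter-+ (suc a) b d = cong φ (iter-+ a b d)

  iter-injective : ∀ k d d′ → IsDart d → IsDart d′ → iter k d ≡ iter k d′ → d ≡ d′
  iter-injective zero d d′ h h′ eq = eq
  iter-injective (suc k) d d′ h h′ eq = iter-injective k d d′ h h′
    (φ-injective _ _ (iter-dart k d h) (iter-dart k d′ h′) eq)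

  φ≢ : ∀ d → IsDart d → φ d ≢ d
  φ≢ (v , u) h eq = noLoop v (subst (_∈ rot v) (cong proj₁ eq) h)

  φφ≢ : ∀ d → IsDart d → φ (φ d) ≢ d
  φφ≢ (v , u) h eq = nextIn≢ (noDup u) (symmetric u v h) (≤-trans (s≤s (s≤s z≤n)) (5≤deg u)) (cong proj₁ eq)

  dart∈darts : ∀ d → IsDart d → d ∈ darts
  dart∈darts (v , u) h = ∈-concatMap⁺ (λ w → map (w ,_) (rot w)) (Any.map (λ { refl → ∈-map⁺ (v ,_) h }) (∈-vertices v))

  -- Two of the first `length darts + 1` iterates coincide, and injectivity cancels their common
  -- beginning. The upper bound matters because `orbitMin` looks no further.
  period : ∀ d → IsDart d → ∃ λ p → 1 ≤ p × p ≤ length darts × iter p d ≡ d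
  period d h = p , m<n⇒0<n∸m i<j , ≤-trans (m∸n≤m (toℕ j) (toℕ i)) (≤-pred (toℕ<n j)) , returns
    where
    position : ∀ k → iter k d ∈ darts
    position k = dart∈darts (iter k d) (iter-dart k d h)
    collision = pigeonhole (n<1+n (length darts)) (λ k → Any.index (position (toℕ k)))
    i = proj₁ collision
    j = proj₁ (proj₂ collision)
    i<j = proj₁ (proj₂ (proj₂ collision))
    p = toℕ j ∸ toℕ i
    same : iter (toℕ i) d ≡ iter (toℕ j) d
    same = trans (lookup-index (position (toℕ i)))
      (trans (cong (lookup darts) (proj₂ (proj₂ (proj₂ collision)))) (sym (lookup-index (position (toℕ j)))))
    returns : iter p d ≡ d
    returns = sym (iter-injective (toℕ i) d (iter p d) h (iter-dart p d h)
      (trans same (trans (cong (λ k → iter k d) (sym (m+[n∸m]≡n (<⇒≤ i<j)))) (iter-+ (toℕ i) p d))))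

  minUpTo-≤ : ∀ d m → minUpTo rot d m ≡ true → ∀ k → 1 ≤ k → k ≤ m → key d ≤ key (iter k d)
  minUpTo-≤ d zero _ (suc k) _ ()
  minUpTo-≤ d (suc m) eq k 1≤k k≤ with ∧-true eq | k ≟ suc m
  ... | here-≤ , _ | yes refl = isYes⇒ (key d ≤? _) here-≤
  ... | _ , below | no k≢ = minUpTo-≤ d m below k 1≤k (≤-pred (≤∧≢⇒< k≤ k≢))

  orbitMin-≤ : ∀ d → orbitMin d ≡ true → ∀ k → 1 ≤ k → k ≤ length darts → key d ≤ key (iter k d)
  orbitMin-≤ d eq = minUpTo-≤ d (length darts) (trans (sym (orbitMin-unfold rot d)) eq)

  key-injective : ∀ d d′ → key d ≡ key d′ → d ≡ d′
  key-injective (v , u) (v′ , u′) eq with combine-injective v u v′ u′ (toℕ-injective (begin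
      toℕ (combine v u)          ≡⟨ toℕ-combine v u ⟩
      suc n * toℕ v + toℕ u      ≡⟨ cong (_+ toℕ u) (*-comm (suc n) (toℕ v)) ⟩
      toℕ v * suc n + toℕ u      ≡⟨ eq ⟩
      toℕ v′ * suc n + toℕ u′    ≡⟨ cong (_+ toℕ u′) (*-comm (toℕ v′) (suc n)) ⟩
      suc n * toℕ v′ + toℕ u′    ≡⟨ sym (toℕ-combine v′ u′) ⟩
      toℕ (combine v′ u′)        ∎))
    where open ≡-Reasoning
  ... | refl , refl = refl

  -- If the period `p` exceeds `k`, then `p ∸ k` further steps lead back to `d`, so the two keys
  -- bound each other. A period of at most `k` must be 3, as faces of length 1 and 2 do not exist,
  -- and then `k = 3` contradicts `iter k d ≢ d`.
  orbitMin-unique : ∀ d k → IsDart d → 1 ≤ k → k ≤ 3 → iter k d ≢ d →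
    ¬ (orbitMin d ≡ true × orbitMin (iter k d) ≡ true)
  orbitMin-unique d k h 1≤k k≤3 moved (min , min′) with period d h
  ... | p , 1≤p , p≤ , returns with k <? p
  ...   | yes k<p = moved (sym (key-injective d (iter k d) (≤-antisym
          (orbitMin-≤ d min k 1≤k (≤-trans (<⇒≤ k<p) p≤))
          (subst (λ e → key (iter k d) ≤ key e) back
            (orbitMin-≤ (iter k d) min′ (p ∸ k) (m<n⇒0<n∸m k<p) (≤-trans (m∸n≤m p k) p≤))))))
    where
    back : iter (p ∸ k) (iter k d) ≡ d
    back = trans (sym (iter-+ (p ∸ k) k d)) (trans (cong (λ m → iter m d) (m∸n+n≡m (<⇒≤ k<p))) returns)
  ...   | no k≮p = short p 1≤p (≮⇒≥ k≮p) returns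
    where
    short : ∀ p → 1 ≤ p → p ≤ k → iter p d ≡ d → ⊥
    short 1 _ _ eq = φ≢ d h eq
    short 2 _ _ eq = φφ≢ d h eq
    short 3 _ 3≤k eq = moved (subst (λ m → iter m d ≡ d) (≤-antisym 3≤k k≤3) eq)
    short (suc (suc (suc (suc p)))) _ 4≤k _ with s≤s (s≤s (s≤s ())) ← ≤-trans 4≤k k≤3

  tri : Dart (suc n) → Bool
  tri d = eqᶠ (proj₁ (iter 3 d)) (proj₁ d) ∧ eqᶠ (proj₂ (iter 3 d)) (proj₂ d)

  tri⇒ : ∀ d → tri d ≡ true → iter 3 d ≡ d
  tri⇒ d eq = cong₂ _,_ (eqᶠ⇒≡ (proj₁ (∧-true eq))) (eqᶠ⇒≡ (proj₂ (∧-true eq)))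

  ⇒tri : ∀ d → iter 3 d ≡ d → tri d ≡ true
  ⇒tri d eq = cong₂ _∧_ (agree (cong proj₁ eq)) (agree (cong proj₂ eq))
    where
    agree : ∀ {a b : Fin (suc n)} → a ≡ b → eqᶠ a b ≡ true
    agree {a} refl = eqᶠ-refl a

  tri-φ : ∀ d → IsDart d → tri (φ d) ≡ tri d
  tri-φ d h with tri d in eq | tri (φ d) in eq′
  ... | true | true = refl
  ... | false | false = refl
  ... | true | false = trans (sym eq′) (⇒tri (φ d) (cong φ (tri⇒ d eq)))
  ... | false | true = trans (sym (⇒tri d (φ-injective (iter 3 d) d (iter-dart 3 d h) h (tri⇒ (φ d) eq′)))) eq

  numFaces-∑ : numFaces ≡ ∑D (⟦_⟧ ∘ orbitMin)
  numFaces-∑ = trans (cong₂ _+_ (trans (length-filter orbitMin darts) (∑-darts _))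
      (trans (length-filter isolated V) (trans (∑-cong V (λ {v} _ → cong ⟦_⟧ (notIsolated v))) (∑-const V 0))))
    (+-identityʳ _)
    where
    notIsolated : ∀ v → isolated v ≡ false
    notIsolated v with rot v | 5≤deg v
    ... | _ ∷ _ | _ = refl

  -- Vertex 0 represents its component because no vertex has a smaller index.
  numComponents≥1 : 1 ≤ numComponents
  numComponents≥1 = subst (1 ≤_) (sym (length-filter compRep V)) (∑-vertices≥1 compRep zero
    (all-true _ V (λ u → Bool.∨-zeroʳ (not (reach (suc n) zero u)))))

  nontri : Dart (suc n) → ℕ
  nontri d = ⟦ not (tri d) ⟧

  -- A face of length 3 accounts for 3 darts, a longer one for at least 4.
  face-bound : 12 * numFaces + ∑D nontri ≤ 4 * length darts
  face-bound = begin
      12 * numFaces + ∑D nontri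
        ≡⟨ cong (λ m → 12 * m + ∑D nontri) numFaces-∑ ⟩
      12 * ∑D m₀ + ∑D nontri
        ≡⟨ cong (_+ ∑D nontri) spread ⟩
      ∑D visits + ∑D nontri
        ≡⟨ sym (∑D-+ visits nontri) ⟩
      ∑D (λ d → visits d + nontri d)
        ≤⟨ ∑D-mono local ⟩
      ∑D (λ _ → 4 * 1)
        ≡⟨ ∑D-* 4 (λ _ → 1) ⟩
      4 * ∑D (λ _ → 1)
        ≡⟨ cong (4 *_) (sym (trans (length-∑ darts) (∑-darts (λ _ → 1)))) ⟩
      4 * length darts ∎
    where
    open ≤-Reasoning
    m₀ t visits : Dart (suc n) → ℕ
    m₀ d = ⟦ orbitMin d ⟧
    t d = ⟦ tri d ⟧
    m₁₂ m₀₁₂ m₂₃ m₁₂₃ m₀₁₂₃ : Dart (suc n) → ℕ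
    m₁₂ d = m₀ (φ d) + m₀ (φ (φ d))
    m₀₁₂ d = m₀ d + m₁₂ d
    m₂₃ d = m₀ (φ (φ d)) + m₀ (φ (φ (φ d)))
    m₁₂₃ d = m₀ (φ d) + m₂₃ d
    m₀₁₂₃ d = m₀ d + m₁₂₃ d
    -- A window of 3 darts with weight 4, or of 4 darts with weight 3: summed over all darts, each
    -- minimal dart counts 12 times. No window contains two minimal darts, so one dart contributes
    -- at most 4, respectively 3, which leaves room for its `nontri`.
    visits d = 4 * (t d * m₀₁₂ d) + 3 * (nontri d * m₀₁₂₃ d)

    apart : ∀ d → IsDart d → ∀ k → 1 ≤ k → k ≤ 2 → ¬ (orbitMin d ≡ true × orbitMin (iter k d) ≡ true)
    apart d h 1 1≤ _ = orbitMin-unique d 1 h 1≤ (s≤s z≤n) (φ≢ d h)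
    apart d h 2 1≤ _ = orbitMin-unique d 2 h 1≤ (s≤s (s≤s z≤n)) (φφ≢ d h)
    apart d h (suc (suc (suc k))) _ (s≤s (s≤s ()))

    1≤1 = s≤s z≤n
    1≤2 = s≤s z≤n
    2≤2 = s≤s (s≤s z≤n)

    local : ∀ d → IsDart d → visits d + nontri d ≤ 4
    local d h with tri d in eq
    ... | true = ≤-trans (≤-reflexive (only₃ (m₀₁₂ d) (m₀₁₂₃ d)))
          (*-monoʳ-≤ 4 (atMostOne₃ _ _ _ (apart d h 1 1≤1 1≤2) (apart d h 2 1≤2 2≤2) (apart (φ d) (φ-dart d h) 1 1≤1 1≤2)))
      where
      only₃ : ∀ x y → 4 * (1 * x) + 3 * (0 * y) + 0 ≡ 4 * x
      only₃ = solve-∀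
    ... | false = ≤-trans (≤-reflexive (only₄ (m₀₁₂ d) (m₀₁₂₃ d)))
          (+-monoˡ-≤ 1 (*-monoʳ-≤ 3 (atMostOne₄ _ _ _ _ (apart d h 1 1≤1 1≤2) (apart d h 2 1≤2 2≤2)
            (orbitMin-unique d 3 h (s≤s z≤n) ≤-refl (λ back → true≢false (trans (sym (⇒tri d back)) eq)))
            (apart (φ d) (φ-dart d h) 1 1≤1 1≤2) (apart (φ d) (φ-dart d h) 2 1≤2 2≤2)
            (apart (φ (φ d)) (iter-dart 2 d h) 1 1≤1 1≤2))))
      where
      only₄ : ∀ x y → 4 * (0 * x) + 3 * (1 * y) + 1 ≡ 3 * y + 1
      only₄ = solve-∀
      true≢false : true ≢ false
      true≢false ()

    shift : ∀ (c f : Dart (suc n) → ℕ) → (∀ d → IsDart d → c (φ d) ≡ c d) →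
      ∑D (λ d → c d * f (φ d)) ≡ ∑D (λ d → c d * f d)
    shift c f inv = trans (∑D-cong (λ d h → cong (_* f (φ d)) (sym (inv d h)))) (∑D-φ (λ d → c d * f d))

    spread : 12 * ∑D m₀ ≡ ∑D visits
    spread = sym (begin-equality
        ∑D visits
          ≡⟨ ∑D-+ (λ d → 4 * (t d * m₀₁₂ d)) (λ d → 3 * (nontri d * m₀₁₂₃ d)) ⟩
        ∑D (λ d → 4 * (t d * m₀₁₂ d)) + ∑D (λ d → 3 * (nontri d * m₀₁₂₃ d))
          ≡⟨ cong₂ _+_ (trans (∑D-* 4 (λ d → t d * m₀₁₂ d)) (cong (4 *_) three))
            (trans (∑D-* 3 (λ d → nontri d * m₀₁₂₃ d)) (cong (3 *_) four)) ⟩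
        4 * (∑D (w t) + (∑D (w t) + ∑D (w t))) + 3 * (∑D (w nontri) + (∑D (w nontri) + (∑D (w nontri) + ∑D (w nontri))))
          ≡⟨ twelve (∑D (w t)) (∑D (w nontri)) ⟩
        12 * (∑D (w t) + ∑D (w nontri))
          ≡⟨ cong (12 *_) (trans (sym (∑D-+ (w t) (w nontri))) (∑D-cong (λ d _ → either d))) ⟩
        12 * ∑D m₀ ∎)
      where
      w : (Dart (suc n) → ℕ) → Dart (suc n) → ℕ
      w c d = c d * m₀ d
      twelve : ∀ a b → 4 * (a + (a + a)) + 3 * (b + (b + (b + b))) ≡ 12 * (a + b)
      twelve = solve-∀
      either : ∀ d → w t d + w nontri d ≡ m₀ d
      either d with tri d
      ... | true = trans (+-identityʳ _) (+-identityʳ _)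
      ... | false = +-identityʳ _
      t-φ : ∀ d → IsDart d → t (φ d) ≡ t d
      t-φ d h = cong ⟦_⟧ (tri-φ d h)
      nontri-φ : ∀ d → IsDart d → nontri (φ d) ≡ nontri d
      nontri-φ d h = cong (⟦_⟧ ∘ not) (tri-φ d h)
      module _ (c : Dart (suc n) → ℕ) (inv : ∀ d → IsDart d → c (φ d) ≡ c d) where
        distribute : ∀ (f g : Dart (suc n) → ℕ) → ∑D (λ d → c d * (f d + g d)) ≡ ∑D (λ d → c d * f d) + ∑D (λ d → c d * g d)
        distribute f g = trans (∑D-cong (λ d _ → *-distribˡ-+ (c d) (f d) (g d))) (∑D-+ (λ d → c d * f d) (λ d → c d * g d))
        once : ∑D (λ d → c d * m₀ (φ d)) ≡ ∑D (w c)
        once = shift c m₀ inv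
        twice : ∑D (λ d → c d * m₀ (φ (φ d))) ≡ ∑D (w c)
        twice = trans (shift c (m₀ ∘ φ) inv) once
        thrice : ∑D (λ d → c d * m₀ (φ (φ (φ d)))) ≡ ∑D (w c)
        thrice = trans (shift c (m₀ ∘ φ ∘ φ) inv) twice
      three = trans (distribute t t-φ m₀ m₁₂) (cong (∑D (w t) +_)
        (trans (distribute t t-φ (m₀ ∘ φ) (m₀ ∘ φ ∘ φ)) (cong₂ _+_ (once t t-φ) (twice t t-φ))))
      four = trans (distribute nontri nontri-φ m₀ m₁₂₃) (cong (∑D (w nontri) +_)
        (trans (distribute nontri nontri-φ (m₀ ∘ φ) m₂₃) (cong₂ _+_ (once nontri nontri-φ)
          (trans (distribute nontri nontri-φ (m₀ ∘ φ ∘ φ) (m₀ ∘ φ ∘ φ ∘ φ))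
            (cong₂ _+_ (twice nontri nontri-φ) (thrice nontri nontri-φ))))))

  -- Six times Euler's formula with the faces eliminated by `face-bound`; strict because there is at
  -- least one component.
  euler-bound : 2 * ∑ V deg + ∑ V (λ u → ∑ (rot u) (λ a → nontri (a , u))) < 12 * suc n
  euler-bound = +-cancelʳ-< (12 * numFaces) _ _ (begin-strict
      2 * ∑ V deg + ∑ V (λ u → ∑ (rot u) (λ a → nontri (a , u))) + 12 * numFaces
        ≡⟨ cong₂ (λ x y → 2 * x + y + 12 * numFaces) (sym #darts) (sym (handshake (λ a u → nontri (a , u)))) ⟩
      2 * length darts + ∑D nontri + 12 * numFaces
        ≡⟨ collect (length darts) (∑D nontri) numFaces ⟩
      2 * length darts + (12 * numFaces + ∑D nontri)
        ≤⟨ +-monoʳ-≤ (2 * length darts) face-bound ⟩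
      2 * length darts + 4 * length darts
        <⟨ m<n+m _ {24 * numComponents} (*-mono-≤ {1} {24} (s≤s z≤n) numComponents≥1) ⟩
      24 * numComponents + (2 * length darts + 4 * length darts)
        ≡⟨ sixfold numComponents (length darts) ⟩
      6 * (4 * numComponents + length darts)
        ≡⟨ cong (6 *_) (sym euler) ⟩
      6 * (2 * suc n + 2 * numFaces)
        ≡⟨ unfold₆ (suc n) numFaces ⟩
      12 * suc n + 12 * numFaces ∎)
    where
    open ≤-Reasoning
    #darts : length darts ≡ ∑ V deg
    #darts = trans (length-∑ darts) (trans (∑-darts (λ _ → 1)) (∑-cong V (λ {v} _ → sym (length-∑ (rot v)))))
    collect : ∀ d t f → 2 * d + t + 12 * f ≡ 2 * d + (12 * f + t)
    collect = solve-∀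
    sixfold : ∀ c d → 24 * c + (2 * d + 4 * d) ≡ 6 * (4 * c + d)
    sixfold = solve-∀
    unfold₆ : ∀ m f → 6 * (2 * m + 2 * f) ≡ 12 * m + 12 * f
    unfold₆ = solve-∀

-- Degree classes and the discharging rules

data Class : Set where
  5° 6° 9° 10° 11° 12° 13-17° 18+° : Class

-- The degrees 0–4, 7 and 8, which do not occur, also land in 5°.
classify : ℕ → Class
classify 6 = 6°
classify 9 = 9°
classify 10 = 10°
classify 11 = 11°
classify 12 = 12°
classify 13 = 13-17°
classify 14 = 13-17°
classify 15 = 13-17°
classify 16 = 13-17°
classify 17 = 13-17°
classify (suc (suc (suc (suc (suc (suc (suc (suc (suc (suc (suc (suc (suc (suc (suc (suc (suc (suc d)))))))))))))))))) = 18+°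
classify _ = 5°

-- The largest degree of the class. Degrees 13 to 17 can share a class because no bound of the seven
-- stars separates them.
capacity : Class → Bound
capacity 5° = just 5
capacity 6° = just 6
capacity 9° = just 9
capacity 10° = just 10
capacity 11° = just 11
capacity 12° = just 12
capacity 13-17° = just 17
capacity 18+° = nothing

fits : Class → Bound → Bool
fits c nothing = true
fits c (just k) with capacity c
... | just m = m ≤ᵇ k
... | nothing = false

major big is5 is6 is10 : Class → Bool
major 5° = false
major 6° = false
major _ = true
big 5° = false
big _ = true
is5 = not ∘ big
is6 6° = true
is6 _ = false
is10 10° = true
is10 _ = false

fitsAll : Class × Class × Class × Class × Class → Bound × Bound × Bound × Bound × Bound → Bool
fitsAll (a , b , c , d , e) (k₁ , k₂ , k₃ , k₄ , k₅) = fits a k₁ ∧ fits b k₂ ∧ fits c k₃ ∧ fits d k₄ ∧ fits e k₅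

starBounds : List (Bound × Bound × Bound × Bound × Bound)
starBounds = (just 5 , just 6 , just 6 , just 5 , nothing)
  ∷ (just 5 , just 6 , just 6 , just 6 , just 17)
  ∷ (just 6 , just 6 , just 6 , just 6 , just 11)
  ∷ (just 5 , just 6 , just 9 , just 5 , just 10)
  ∷ (just 5 , just 6 , just 11 , just 5 , just 9)
  ∷ (just 5 , just 5 , just 10 , just 5 , just 12)
  ∷ (just 5 , just 5 , just 9 , just 5 , just 17)
  ∷ []

star : Class → Class → Class → Class → Class → Bool
star a b c d e = any (λ k → any (λ t → fitsAll t k) (dihedral5 a b c d e)) starBounds

-- What a neighbour of class z sends to a 5-vertex with neighbours z, a, b, c, d in cyclic order; full means that all
-- faces at the 5-vertex are triangles.
send : Class → Bool → Class → Class → Class → Class → ℕ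
send 5° _ _ _ _ _ = 0
send 6° _ _ _ _ _ = 0
send 9° full a _ _ d = if full ∧ (big a ∨ big d) then 30 else 20
send 10° full a _ _ d = if full ∧ (big a ∨ big d) then 36 else 24
send 11° full a b c d =
  if big a ∨ big d
  then (if full
    then (if is6 a ∧ is5 b ∧ is10 c ∧ is5 d ∨ is5 a ∧ is10 b ∧ is5 c ∧ is6 d then 36 else 30)
    else 15)
  else (if major b ∧ major c then 0 else
    if full then (if is6 b ∧ is10 c ∨ is10 b ∧ is6 c then 24 else 30) else 15)
send 12° full a _ _ d =
  if full then (if big a ∧ big d then 60 else if big a ∨ big d then 40 else 30) else 30
send 13-17° full a b c d =
  if big a ∨ big d
  then (if full then (if big a ∧ big d then 60 else 40) else 30)
  else (if major b ∧ major c then 0 else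
    if full then (if is5 b ∧ is10 c ∨ is10 b ∧ is5 c then 36 else 30) else 15)
send 18+° full a _ _ d = if full ∧ (big a ∨ big d) then 60 else 40

-- What a 5-vertex with neighbours a, b, c, d, e in cyclic order gives to its neighbour a.  It can spare 12, since
-- the fifth neighbour has degree at least 6 (no ⟨5,5,10,5,12⟩-star) and both 10-vertices send 36, or 24 plus 30 from a face.
aid : Class → Class → Class → Class → Class → ℕ
aid 5° 5° 10° _ 10° = 6
aid 5° 10° _ 10° 5° = 6
aid _ _ _ _ _ = 0

received : Bool → Class → Class → Class → Class → Class → ℕ
received f a b c d e = send a f b c d e + (send b f c d e a + (send c f d e a b + (send d f e a b c + send e f a b c d)))

aidGiven : Class → Class → Class → Class → Class → ℕ
aidGiven a b c d e = aid a b c d e + (aid b c d e a + (aid c d e a b + (aid d e a b c + aid e a b c d)))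

-- A single non-triangular corner is credited, however many there are.
fromFaces : Bool → ℕ
fromFaces full = if full then 0 else 30

-- The 60 is the initial deficit of a 5-vertex.
satisfied : Bool → Class → Class → Class → Class → Class → Bool
satisfied f a b c d e = 60 + aidGiven a b c d e ≤ᵇ fromFaces f + received f a b c d e

∀C : (Class → Bool) → Bool
∀C p = p 5° ∧ p 6° ∧ p 9° ∧ p 10° ∧ p 11° ∧ p 12° ∧ p 13-17° ∧ p 18+°

∀C-sound : ∀ p → ∀C p ≡ true → ∀ c → p c ≡ true
∀C-sound p eq with ∧-true {p 5°} eq
... | e5 , eq with ∧-true {p 6°} eq
... | e6 , eq with ∧-true {p 9°} eq
... | e9 , eq with ∧-true {p 10°} eq
... | e10 , eq with ∧-true {p 11°} eq
... | e11 , eq with ∧-true {p 12°} eq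
... | e12 , eq with ∧-true {p 13-17°} eq
... | e13 , e18 = λ { 5° → e5 ; 6° → e6 ; 9° → e9 ; 10° → e10 ; 11° → e11 ; 12° → e12 ; 13-17° → e13 ; 18+° → e18 }

check : Bool → Class → Class → Class → Class → Class → Bool
check f a b c d e = satisfied f a b c d e ∨ star a b c d e

-- Evaluation over all patterns of five classes, for both values of `f`, replaces the case analysis
-- at a 5-vertex.
check-all : ∀ f → ∀C (λ a → ∀C (λ b → ∀C (λ c → ∀C (λ d → ∀C (check f a b c d))))) ≡ true
check-all false = refl
check-all true = refl

_⇒_ : Bool → Bool → Bool
a ⇒ b = not a ∨ b
infixr 4 _⇒_

⇒-elim : ∀ {a b} → (a ⇒ b) ≡ true → a ≡ true → b ≡ true
⇒-elim {true} eq _ = eq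

⇒-intro : ∀ {a b} → (a ≡ true → b ≡ true) → (a ⇒ b) ≡ true
⇒-intro {true} h = h refl
⇒-intro {false} h = refl

∧-intro : ∀ {a b} → a ≡ true → b ≡ true → a ∧ b ≡ true
∧-intro refl refl = refl

∨-left : ∀ {a b} → a ∨ b ≡ true → b ≡ false → a ≡ true
∨-left {true} _ _ = refl
∨-left {false} refl ()

≤ᵇ-elim : ∀ m {n} → (m ≤ᵇ n) ≡ true → m ≤ n
≤ᵇ-elim m eq = ≤ᵇ⇒≤ m _ (subst T (sym eq) _)

∀C⁴ : (Class → Class → Class → Class → Bool) → Bool
∀C⁴ p = ∀C λ a → ∀C λ b → ∀C λ c → ∀C (p a b c)

∀C⁴-sound : ∀ p → ∀C⁴ p ≡ true → ∀ a b c d → p a b c d ≡ true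
∀C⁴-sound p eq a b c = ∀C-sound (p a b c) (∀C-sound (λ c → ∀C (p a b c)) (∀C-sound (λ b → ∀C λ c → ∀C (p a b c))
  (∀C-sound (λ a → ∀C λ b → ∀C λ c → ∀C (p a b c)) eq a) b) c)

satisfied-or-star : ∀ f a b c d e → star a b c d e ≡ false →
  60 + aidGiven a b c d e ≤ fromFaces f + received f a b c d e
satisfied-or-star f a b c d e free = ≤ᵇ-elim (60 + aidGiven a b c d e)
  (∨-left (∀C⁴-sound (check f a) (∀C-sound (λ a → ∀C⁴ (check f a)) (check-all f) a) b c d e) free)

is13-17 : Class → Bool
is13-17 13-17° = true
is13-17 _ = false

-- The 5-vertices that need 36 from a neighbour z of degree 13–17, because the other major neighbour has degree 10.
-- If one of them gets aid from its 5-neighbour opposite to z, it passes the aid on to z.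
special⁻ special⁺ : Class → Bool → Class → Class → Class → Class → Bool
special⁻ z f a b c d = is13-17 z ∧ f ∧ is5 a ∧ is5 b ∧ is10 c ∧ is5 d
special⁺ z f a b c d = is13-17 z ∧ f ∧ is5 a ∧ is10 b ∧ is5 c ∧ is5 d

-- The 5-vertices that need 36 from a neighbour of degree 11.
tight⁺ tight⁻ : Bool → Class → Class → Class → Class → Bool
tight⁺ f a b c d = f ∧ is6 a ∧ is5 b ∧ is10 c ∧ is5 d
tight⁻ f a b c d = f ∧ is5 a ∧ is10 b ∧ is5 c ∧ is6 d

-- Finite checks for the major vertices

module Bounds where
  -- h is the part of the share of a neighbour of degree at least 6 that goes to either side.
  bonus : Bool → ℕ → Class → Class → ℕ
  bonus f h a d = if f then h * (⟦ big a ⟧ + ⟦ big d ⟧) else 0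

  -- 60 (d − 6) / d for d = 9, 10, 12, 18
  share : Class → ℕ
  share 9° = 20
  share 10° = 24
  share 12° = 30
  share 18+° = 40
  share _ = 0

  uniform : Class → Bool
  uniform 9° = true
  uniform 10° = true
  uniform 12° = true
  uniform 18+° = true
  uniform _ = false

  -- A neighbour of degree at least 6 passes half of its share to either side; doubling avoids the
  -- division.
  uniform-check : Class → Bool → Class → Class → Class → Class → Bool
  uniform-check z f a b c d = uniform z ⇒ (2 * send z f a b c d ≤ᵇ 2 * share z + bonus f (share z) a d)

  uniform-all : ∀ f → ∀C (λ z → ∀C⁴ (uniform-check z f)) ≡ true
  uniform-all false = refl
  uniform-all true = refl

  uniform-bound : ∀ z f a b c d → uniform z ≡ true → 2 * send z f a b c d ≤ 2 * share z + bonus f (share z) a d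
  uniform-bound z f a b c d ev = ≤ᵇ-elim (2 * send z f a b c d)
    (⇒-elim (∀C⁴-sound (uniform-check z f) (∀C-sound (λ z → ∀C⁴ (uniform-check z f)) (uniform-all f) z) a b c d) ev)

  -- The 6 per side admits the tight vertices, which send for 36 next to a 6-vertex. A neighbour of
  -- degree at least 6 still saves 30 - 2·6 = 18.
  11-check : Bool → Class → Class → Class → Class → Bool
  11-check f a b c d = send 11° f a b c d ≤ᵇ 30 + bonus f 6 a d

  11-all : ∀ f → ∀C⁴ (11-check f) ≡ true
  11-all false = refl
  11-all true = refl

  11-bound : ∀ f a b c d → send 11° f a b c d ≤ 30 + bonus f 6 a d
  11-bound f a b c d = ≤ᵇ-elim (send 11° f a b c d) (∀C⁴-sound (11-check f) (11-all f) a b c d)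

  -- i (j) records that the previous (next) neighbour of z is tight and charges 6 to the present one.
  tight-hyp : Bool → Bool → Bool → Class → Class → Class → Class → Bool
  tight-hyp f i j a b c d = (i ⇒ is5 a ∧ is10 b ∧ (f ⇒ is5 d)) ∧ (j ⇒ is5 d ∧ is10 c ∧ (f ⇒ is5 a))

  tight-check : Bool → Bool → Bool → Class → Class → Class → Class → Bool
  tight-check f i j a b c d = tight-hyp f i j a b c d ⇒
    (send 11° f a b c d + (6 * ⟦ i ⟧ + 6 * ⟦ j ⟧) ≤ᵇ 30 + (6 * ⟦ tight⁺ f a b c d ⟧ + 6 * ⟦ tight⁻ f a b c d ⟧))
      ∨ star 11° a b c d

  tight-all : ∀ f i j → ∀C⁴ (tight-check f i j) ≡ true
  tight-all false false false = refl
  tight-all false false true = refl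
  tight-all false true false = refl
  tight-all false true true = refl
  tight-all true false false = refl
  tight-all true false true = refl
  tight-all true true false = refl
  tight-all true true true = refl

  -- A charged full vertex has both sides of degree 5 and a 10-vertex opposite to z. Without a
  -- ⟨5,5,10,5,12⟩-star its other opposite neighbour has degree at least 6, so it takes 24 if that
  -- degree is 6 and nothing otherwise. A vertex that is not full takes at most 15 and can bear both
  -- charges.
  tight-bound : ∀ f i j a b c d → star 11° a b c d ≡ false → tight-hyp f i j a b c d ≡ true →
    send 11° f a b c d + (6 * ⟦ i ⟧ + 6 * ⟦ j ⟧) ≤ 30 + (6 * ⟦ tight⁺ f a b c d ⟧ + 6 * ⟦ tight⁻ f a b c d ⟧)
  tight-bound f i j a b c d free hyp = ≤ᵇ-elim (send 11° f a b c d + (6 * ⟦ i ⟧ + 6 * ⟦ j ⟧))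
    (∨-left (⇒-elim (∀C⁴-sound (tight-check f i j) (tight-all f i j) a b c d) hyp) free)

  -- i (j) records that the next (previous) neighbour of z is special, without refund, and charges 3 to the present one.
  special-hyp : Bool → Bool → Bool → Class → Class → Class → Class → Bool
  special-hyp f i j a b c d = (i ⇒ is5 d ∧ is5 c ∧ (f ⇒ not (is10 b))) ∧ (j ⇒ is5 a ∧ is5 b ∧ (f ⇒ not (is10 c)))

  twoSided : Bool → Class → Class → Bool
  twoSided f a d = f ∧ big a ∧ big d

  special-check : ℕ → Bool → Bool → Bool → Bool → Class → Class → Class → Class → Bool
  special-check h two f i j a b c d = (twoSided f a d ⇒ two) ∧ special-hyp f i j a b c d ⇒
    (2 * (send 13-17° f a b c d + (3 * ⟦ i ⟧ + 3 * ⟦ j ⟧)) ≤ᵇ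
      66 + bonus f h a d + 6 * (⟦ special⁻ 13-17° f a b c d ⟧ + ⟦ special⁺ 13-17° f a b c d ⟧))
      ∨ star 13-17° a b c d

  -- In doubled units: 2·60 = 66 + 2·27 for two big sides, and 2·(40 + 3) = 66 + 20 for one big side
  -- together with one charge of 3.
  perSide : Bool → ℕ
  perSide two = if two then 27 else 20

  special-all : ∀ two f i j → ∀C⁴ (special-check (perSide two) two f i j) ≡ true
  special-all false false false false = refl
  special-all false false false true = refl
  special-all false false true false = refl
  special-all false false true true = refl
  special-all false true false false = refl
  special-all false true false true = refl
  special-all false true true false = refl
  special-all false true true true = refl
  special-all true false false false = refl
  special-all true false false true = refl
  special-all true false true false = refl
  special-all true false true true = refl
  special-all true true false false = refl
  special-all true true false true = refl
  special-all true true true false = refl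
  special-all true true true true = refl

  -- Consider a charged full vertex with sides of degree 5. One opposite neighbour has degree 5, and
  -- the other is neither at most 6 (⟨5,6,6,5,∞⟩) nor 9 (⟨5,5,9,5,17⟩) nor, by hypothesis, 10. Hence
  -- it takes 30, and 30 + 3 meets the rate 33.
  special-bound : ∀ two f i j a b c d → star 13-17° a b c d ≡ false →
    (twoSided f a d ⇒ two) ≡ true → special-hyp f i j a b c d ≡ true →
    2 * (send 13-17° f a b c d + (3 * ⟦ i ⟧ + 3 * ⟦ j ⟧)) ≤
      66 + bonus f (perSide two) a d + 6 * (⟦ special⁻ 13-17° f a b c d ⟧ + ⟦ special⁺ 13-17° f a b c d ⟧)
  special-bound two f i j a b c d free hyp₁ hyp₂ = ≤ᵇ-elim (2 * (send 13-17° f a b c d + (3 * ⟦ i ⟧ + 3 * ⟦ j ⟧)))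
    (∨-left (⇒-elim (∀C⁴-sound (special-check (perSide two) two f i j) (special-all two f i j) a b c d)
      (∧-intro hyp₁ hyp₂)) free)

  parity-check : Class → Class → Class → Class → Class → Bool
  parity-check z a b c d = is5 a ∧ is5 d ∧ not (major b) ∧ not (major c) ⇒ star z a b c d

  parity-all : ∀C (λ z → ∀C⁴ (parity-check z)) ≡ true
  parity-all = refl

  major-opposite : ∀ z a b c d → is5 a ∧ is5 d ∧ not (major b) ∧ not (major c) ≡ true → star z a b c d ≡ true
  major-opposite z a b c d = ⇒-elim
    (∀C⁴-sound (parity-check z) (∀C-sound (λ z → ∀C⁴ (parity-check z)) parity-all z) a b c d)

parityClass : Class → Bool
parityClass 11° = true
parityClass 13-17° = true
parityClass _ = false

send-between-majors : ∀ z f a b c d → parityClass z ≡ true → is5 a ∧ is5 d ∧ major b ∧ major c ≡ true → send z f a b c d ≡ 0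
send-between-majors 11° f 5° b c 5° _ eq rewrite eq = refl
send-between-majors 13-17° f 5° b c 5° _ eq rewrite eq = refl

send-nonfull : ∀ z a b c d → parityClass z ≡ true → is5 a ∧ is5 d ≡ true → send z false a b c d ≤ 15
send-nonfull 11° 5° b c 5° _ _ with major b ∧ major c
... | true = z≤n
... | false = ≤-refl
send-nonfull 13-17° 5° b c 5° _ _ with major b ∧ major c
... | true = z≤n
... | false = ≤-refl

-- Both patterns would pass on the aid of the same vertex `b`; the left one puts `z` in the class
-- 13-17, the right one makes it a 5-vertex.
special-exclusive : ∀ f z a b c d → ⟦ special⁻ z f a b c d ⟧ + ⟦ special⁺ d f z a b c ⟧ ≤ 1
special-exclusive f z a b c d = ≤ᵇ-elim (⟦ special⁻ z f a b c d ⟧ + ⟦ special⁺ d f z a b c ⟧)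
  (∀C⁴-sound (exclusive f z) (∀C-sound (λ z → ∀C⁴ (exclusive f z)) (exclusive-all f) z) a b c d)
  where
  exclusive : Bool → Class → Class → Class → Class → Class → Bool
  exclusive f z a b c d = ⟦ special⁻ z f a b c d ⟧ + ⟦ special⁺ d f z a b c ⟧ ≤ᵇ 1
  exclusive-all : ∀ f → ∀C (λ z → ∀C⁴ (exclusive f z)) ≡ true
  exclusive-all false = refl
  exclusive-all true = refl

aid-after : ∀ {a b c d e} → a ≡ 5° → b ≡ 5° → c ≡ 10° → e ≡ 10° → aid a b c d e ≡ 6
aid-after refl refl refl refl = refl

aid-before : ∀ {a b c d e} → a ≡ 5° → b ≡ 10° → d ≡ 10° → e ≡ 5° → aid a b c d e ≡ 6
aid-before refl refl refl refl = refl

-- The discharging argument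

any⇒Any : ∀ {A B : Set} (h : A → B) (p : B → Bool) {P : A → Set} (xs : List A) →
  (∀ x → p (h x) ≡ true → P x) → any p (map h xs) ≡ true → Any P xs
any⇒Any h p (x ∷ xs) sound eq with p (h x) in px
... | true = here (sound x px)
... | false = there (any⇒Any h p xs sound eq)

∨-true : ∀ {a b} → a ∨ b ≡ true → a ≡ true ⊎ b ≡ true
∨-true {true} _ = inj₁ refl
∨-true {false} eq = inj₂ eq

dihedral5-rotate : ∀ {A : Set} {P : A × A × A × A × A → Set} {a b c d e} →
  Any P (dihedral5 b c d e a) → Any P (dihedral5 a b c d e)
dihedral5-rotate (here p) = there (here p)
dihedral5-rotate (there (here p)) = there (there (here p))
dihedral5-rotate (there (there (here p))) = there (there (there (here p)))
dihedral5-rotate (there (there (there (here p)))) = there (there (there (there (here p))))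
dihedral5-rotate (there (there (there (there (here p))))) = here p
dihedral5-rotate (there (there (there (there (there (here p)))))) = there (there (there (there (there (there (there (there (there (here p)))))))))
dihedral5-rotate (there (there (there (there (there (there (here p))))))) = there (there (there (there (there (here p)))))
dihedral5-rotate (there (there (there (there (there (there (there (here p)))))))) = there (there (there (there (there (there (here p))))))
dihedral5-rotate (there (there (there (there (there (there (there (there (here p))))))))) = there (there (there (there (there (there (there (here p)))))))
dihedral5-rotate (there (there (there (there (there (there (there (there (there (here p)))))))))) = there (there (there (there (there (there (there (there (here p))))))))

data InClass : Class → ℕ → Set where
  in5 : InClass 5° 5
  in6 : InClass 6° 6
  in9 : InClass 9° 9
  in10 : InClass 10° 10
  in11 : InClass 11° 11
  in12 : InClass 12° 12
  in13-17 : ∀ {d} → 13 ≤ d → d ≤ 17 → InClass 13-17° d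
  in18+ : ∀ {d} → 18 ≤ d → InClass 18+° d

inClass : ∀ d → 5 ≤ d → d ≢ 7 → d ≢ 8 → InClass (classify d) d
inClass 0 () _ _
inClass 1 (s≤s ()) _ _
inClass 2 (s≤s (s≤s ())) _ _
inClass 3 (s≤s (s≤s (s≤s ()))) _ _
inClass 4 (s≤s (s≤s (s≤s (s≤s ())))) _ _
inClass 5 _ _ _ = in5
inClass 6 _ _ _ = in6
inClass 7 _ ≢7 _ = ⊥-elim (≢7 refl)
inClass 8 _ _ ≢8 = ⊥-elim (≢8 refl)
inClass 9 _ _ _ = in9
inClass 10 _ _ _ = in10
inClass 11 _ _ _ = in11
inClass 12 _ _ _ = in12
inClass 13 _ _ _ = in13-17 (m≤m+n 13 0) (m≤m+n 13 4)
inClass 14 _ _ _ = in13-17 (m≤m+n 13 1) (m≤m+n 14 3)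
inClass 15 _ _ _ = in13-17 (m≤m+n 13 2) (m≤m+n 15 2)
inClass 16 _ _ _ = in13-17 (m≤m+n 13 3) (m≤m+n 16 1)
inClass 17 _ _ _ = in13-17 (m≤m+n 13 4) (m≤m+n 17 0)
inClass (suc (suc (suc (suc (suc (suc (suc (suc (suc (suc (suc (suc (suc (suc (suc (suc (suc (suc d)))))))))))))))))) _ _ _ =
  in18+ (m≤m+n 18 d)

fits-sound : ∀ c d k → InClass c d → fits c k ≡ true → d ≤∞ k
fits-sound _ d nothing _ _ = _
fits-sound _ _ (just k) in5 eq = ≤ᵇ-elim 5 eq
fits-sound _ _ (just k) in6 eq = ≤ᵇ-elim 6 eq
fits-sound _ _ (just k) in9 eq = ≤ᵇ-elim 9 eq
fits-sound _ _ (just k) in10 eq = ≤ᵇ-elim 10 eq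
fits-sound _ _ (just k) in11 eq = ≤ᵇ-elim 11 eq
fits-sound _ _ (just k) in12 eq = ≤ᵇ-elim 12 eq
fits-sound _ _ (just k) (in13-17 _ d≤17) eq = ≤-trans d≤17 (≤ᵇ-elim 17 eq)
fits-sound _ _ (just k) (in18+ _) ()

is5⇒≡ : ∀ {c} → is5 c ≡ true → c ≡ 5°
is5⇒≡ {5°} _ = refl

is10⇒≡ : ∀ {c} → is10 c ≡ true → c ≡ 10°
is10⇒≡ {10°} _ = refl

big⇒≢5 : ∀ {c} → is5 c ≡ false → big c ≡ true
big⇒≢5 {6°} _ = refl
big⇒≢5 {9°} _ = refl
big⇒≢5 {10°} _ = refl
big⇒≢5 {11°} _ = refl
big⇒≢5 {12°} _ = refl
big⇒≢5 {13-17°} _ = refl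
big⇒≢5 {18+°} _ = refl

HasSomeStar : ∀ {n} → PlaneGraph n → Set
HasSomeStar G = HasStar G (just 5) (just 6) (just 6) (just 5) nothing
  ⊎ HasStar G (just 5) (just 6) (just 6) (just 6) (just 17)
  ⊎ HasStar G (just 6) (just 6) (just 6) (just 6) (just 11)
  ⊎ HasStar G (just 5) (just 6) (just 9) (just 5) (just 10)
  ⊎ HasStar G (just 5) (just 6) (just 11) (just 5) (just 9)
  ⊎ HasStar G (just 5) (just 5) (just 10) (just 5) (just 12)
  ⊎ HasStar G (just 5) (just 5) (just 9) (just 5) (just 17)

module Discharging {n : ℕ} (G : PlaneGraph (suc n)) (5≤deg : ∀ v → 5 ≤ PlaneGraph.deg G v)
  (≢7 : ∀ v → PlaneGraph.deg G v ≢ 7) (≢8 : ∀ v → PlaneGraph.deg G v ≢ 8) (noStar : ¬ HasSomeStar G) where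
  open PlaneGraph G hiding (_≤ᵇ_)
  open Euler G 5≤deg

  private
    W : Set
    W = Fin (suc n)
    V = vertices (suc n)

  cl : W → Class
  cl v = classify (deg v)

  cl-correct : ∀ v → InClass (cl v) (deg v)
  cl-correct v = inClass (deg v) (5≤deg v) (≢7 v) (≢8 v)

  deg≡5 : ∀ v → cl v ≡ 5° → deg v ≡ 5
  deg≡5 v eq with cl v | cl-correct v
  deg≡5 v refl | .5° | c = five c
    where
    five : ∀ {d} → InClass 5° d → d ≡ 5
    five in5 = refl

  -- w₁ z q, …, w₄ z q are the neighbours of q that follow its neighbour z.
  w₁ w₂ w₃ w₄ : W → W → W
  w₁ z q = nx q z
  w₂ z q = nx q (w₁ z q)
  w₃ z q = nx q (w₂ z q)
  w₄ z q = nx q (w₃ z q)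

  nontriAt : W → ℕ
  nontriAt v = ∑ (rot v) (λ a → nontri (a , v))

  full : W → Bool
  full v = nontriAt v ≡ᵇ 0

  -- A view of `rot q` that is stable under rotation: `HasStar` refers to the list as written,
  -- `stars` to any cyclic shift of it, so an arbitrary neighbour may come first.
  record Cycle (q a b c d e : W) : Set where
    field
      a→b : nx q a ≡ b
      b→c : nx q b ≡ c
      c→d : nx q c ≡ d
      d→e : nx q d ≡ e
      e→a : nx q e ≡ a
      ∑-nbrs : ∀ f → ∑ (rot q) f ≡ f a + (f b + (f c + (f d + f e)))
      stars : ∀ {k₁ k₂ k₃ k₄ k₅} →
        Any (λ { (v₁ , v₂ , v₃ , v₄ , v₅) →
               (deg v₁ ≤∞ k₁) × (deg v₂ ≤∞ k₂) × (deg v₃ ≤∞ k₃) × (deg v₄ ≤∞ k₄) × (deg v₅ ≤∞ k₅) })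
            (dihedral5 a b c d e) →
        HasStar G k₁ k₂ k₃ k₄ k₅

  rotate : ∀ {q a b c d e} → Cycle q a b c d e → Cycle q b c d e a
  rotate C = record
    { a→b = b→c ; b→c = c→d ; c→d = d→e ; d→e = e→a ; e→a = a→b
    ; ∑-nbrs = λ f → trans (∑-nbrs f) (shift (f _) (f _) (f _) (f _) (f _))
    ; stars = λ p → stars (dihedral5-rotate p) }
    where
    open Cycle C
    shift : ∀ a b c d e → a + (b + (c + (d + e))) ≡ b + (c + (d + (e + a)))
    shift = solve-∀

  rot⇒Cycle : ∀ {q a b c d e} → rot q ≡ a ∷ b ∷ c ∷ d ∷ e ∷ [] → Cycle q a b c d e
  rot⇒Cycle {q} {a} {b} {c} {d} {e} eq
    with successors ← subst (λ xs → map (nextIn xs) (a ∷ b ∷ c ∷ d ∷ e ∷ []) ≡ b ∷ c ∷ d ∷ e ∷ a ∷ []) (sym eq)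
           (map-nextIn a (b ∷ c ∷ d ∷ e ∷ []) (subst Unique eq (noDup q)))
    with (n₀ , r₀) ← ∷-injective successors
    with (n₁ , r₁) ← ∷-injective r₀
    with (n₂ , r₂) ← ∷-injective r₁
    with (n₃ , r₃) ← ∷-injective r₂
    with (n₄ , _) ← ∷-injective r₃ = record
    { a→b = n₀ ; b→c = n₁ ; c→d = n₂ ; d→e = n₃ ; e→a = n₄
    ; ∑-nbrs = λ f → trans (cong (λ xs → ∑ xs f) eq)
        (cong (λ k → f a + (f b + (f c + (f d + k)))) (+-identityʳ (f e)))
    ; stars = λ p → q , a , b , c , d , e , eq , p }

  Cycle⇒w : ∀ {q a b c d e} → Cycle q a b c d e → Cycle q a (w₁ a q) (w₂ a q) (w₃ a q) (w₄ a q)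
  Cycle⇒w C with refl ← Cycle.a→b C with refl ← Cycle.b→c C with refl ← Cycle.c→d C with refl ← Cycle.d→e C = C

  cycleFrom : ∀ {q z} xs → rot q ≡ xs → length xs ≡ 5 → z ∈ xs → Cycle q z (w₁ z q) (w₂ z q) (w₃ z q) (w₄ z q)
  cycleFrom (a ∷ b ∷ c ∷ d ∷ e ∷ []) eq _ (here refl) = Cycle⇒w (rot⇒Cycle eq)
  cycleFrom (a ∷ b ∷ c ∷ d ∷ e ∷ []) eq _ (there (here refl)) = Cycle⇒w (rotate (rot⇒Cycle eq))
  cycleFrom (a ∷ b ∷ c ∷ d ∷ e ∷ []) eq _ (there (there (here refl))) = Cycle⇒w (rotate (rotate (rot⇒Cycle eq)))
  cycleFrom (a ∷ b ∷ c ∷ d ∷ e ∷ []) eq _ (there (there (there (here refl)))) =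
    Cycle⇒w (rotate (rotate (rotate (rot⇒Cycle eq))))
  cycleFrom (a ∷ b ∷ c ∷ d ∷ e ∷ []) eq _ (there (there (there (there (here refl))))) =
    Cycle⇒w (rotate (rotate (rotate (rotate (rot⇒Cycle eq)))))

  cycleAt : ∀ {q z} → cl q ≡ 5° → z ∈ rot q → Cycle q z (w₁ z q) (w₂ z q) (w₃ z q) (w₄ z q)
  cycleAt {q} five z∈ = cycleFrom (rot q) refl (deg≡5 q five) z∈

  module _ {q a b c d e} (C : Cycle q a b c d e) where
    private
      starFrom : ∀ k₁ k₂ k₃ k₄ k₅ →
        any (λ t → fitsAll t (k₁ , k₂ , k₃ , k₄ , k₅)) (dihedral5 (cl a) (cl b) (cl c) (cl d) (cl e)) ≡ true →
        HasStar G k₁ k₂ k₃ k₄ k₅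
      starFrom k₁ k₂ k₃ k₄ k₅ eq = Cycle.stars C (any⇒Any
        (λ { (v₁ , v₂ , v₃ , v₄ , v₅) → cl v₁ , cl v₂ , cl v₃ , cl v₄ , cl v₅ })
        (λ t → fitsAll t (k₁ , k₂ , k₃ , k₄ , k₅)) (dihedral5 a b c d e)
        (λ { (v₁ , v₂ , v₃ , v₄ , v₅) eq → sound v₁ v₂ v₃ v₄ v₅ eq }) eq)
        where
        sound : ∀ v₁ v₂ v₃ v₄ v₅ → fitsAll (cl v₁ , cl v₂ , cl v₃ , cl v₄ , cl v₅) (k₁ , k₂ , k₃ , k₄ , k₅) ≡ true →
          (deg v₁ ≤∞ k₁) × (deg v₂ ≤∞ k₂) × (deg v₃ ≤∞ k₃) × (deg v₄ ≤∞ k₄) × (deg v₅ ≤∞ k₅)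
        sound v₁ v₂ v₃ v₄ v₅ eq
          with (f₁ , eq) ← ∧-true {fits (cl v₁) k₁} eq
          with (f₂ , eq) ← ∧-true {fits (cl v₂) k₂} eq
          with (f₃ , eq) ← ∧-true {fits (cl v₃) k₃} eq
          with (f₄ , f₅) ← ∧-true {fits (cl v₄) k₄} eq
          = fits-sound _ _ k₁ (cl-correct v₁) f₁ , fits-sound _ _ k₂ (cl-correct v₂) f₂
          , fits-sound _ _ k₃ (cl-correct v₃) f₃ , fits-sound _ _ k₄ (cl-correct v₄) f₄ , fits-sound _ _ k₅ (cl-correct v₅) f₅

      someStar : star (cl a) (cl b) (cl c) (cl d) (cl e) ≡ true → HasSomeStar G
      someStar eq with ∨-true eq
      ... | inj₁ s = inj₁ (starFrom _ _ _ _ _ s)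
      ... | inj₂ eq with ∨-true eq
      ... | inj₁ s = inj₂ (inj₁ (starFrom _ _ _ _ _ s))
      ... | inj₂ eq with ∨-true eq
      ... | inj₁ s = inj₂ (inj₂ (inj₁ (starFrom _ _ _ _ _ s)))
      ... | inj₂ eq with ∨-true eq
      ... | inj₁ s = inj₂ (inj₂ (inj₂ (inj₁ (starFrom _ _ _ _ _ s))))
      ... | inj₂ eq with ∨-true eq
      ... | inj₁ s = inj₂ (inj₂ (inj₂ (inj₂ (inj₁ (starFrom _ _ _ _ _ s)))))
      ... | inj₂ eq with ∨-true eq
      ... | inj₁ s = inj₂ (inj₂ (inj₂ (inj₂ (inj₂ (inj₁ (starFrom _ _ _ _ _ s))))))
      ... | inj₂ eq with ∨-true eq
      ... | inj₁ s = inj₂ (inj₂ (inj₂ (inj₂ (inj₂ (inj₂ (starFrom _ _ _ _ _ s))))))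
      ... | inj₂ ()

    starless : star (cl a) (cl b) (cl c) (cl d) (cl e) ≡ false
    starless = ¬-not (noStar ∘ someStar)

  -- Charges, and the balance at minor vertices

  S Aid refund flow : W → W → ℕ
  S z q = if is5 (cl q) then send (cl z) (full q) (cl (w₁ z q)) (cl (w₂ z q)) (cl (w₃ z q)) (cl (w₄ z q)) else 0
  Aid m w = if is5 (cl m) then aid (cl w) (cl (w₁ w m)) (cl (w₂ w m)) (cl (w₃ w m)) (cl (w₄ w m)) else 0

  σ⁻ σ⁺ : W → W → Bool
  σ⁻ z q = is5 (cl q) ∧ special⁻ (cl z) (full q) (cl (w₁ z q)) (cl (w₂ z q)) (cl (w₃ z q)) (cl (w₄ z q))
  σ⁺ z q = is5 (cl q) ∧ special⁺ (cl z) (full q) (cl (w₁ z q)) (cl (w₂ z q)) (cl (w₃ z q)) (cl (w₄ z q))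

  refund z q = ⟦ σ⁻ z q ⟧ * Aid (w₂ z q) q + ⟦ σ⁺ z q ⟧ * Aid (w₃ z q) q

  -- `refund u v` is paid by the 5-vertex `v` to the major vertex `u`, hence the reversed arguments.
  flow v u = S v u + (Aid v u + refund u v)

  module _ {q a b c d e} (five : cl q ≡ 5°) (C : Cycle q a b c d e) where
    open Cycle C

    S-cycle : S a q ≡ send (cl a) (full q) (cl b) (cl c) (cl d) (cl e)
    S-cycle with refl ← a→b with refl ← b→c with refl ← c→d with refl ← d→e rewrite five = refl

    A-cycle : Aid q a ≡ aid (cl a) (cl b) (cl c) (cl d) (cl e)
    A-cycle with refl ← a→b with refl ← b→c with refl ← c→d with refl ← d→e rewrite five = refl

    refund-cycle : refund a q ≡ ⟦ special⁻ (cl a) (full q) (cl b) (cl c) (cl d) (cl e) ⟧ * Aid c q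
      + ⟦ special⁺ (cl a) (full q) (cl b) (cl c) (cl d) (cl e) ⟧ * Aid d q
    refund-cycle with refl ← a→b with refl ← b→c with refl ← c→d with refl ← d→e rewrite five = refl

  module _ {q a b c d e} (five : cl q ≡ 5°) (C : Cycle q a b c d e) where
    open Cycle C
    private
      C₁ = rotate C
      C₂ = rotate C₁
      C₃ = rotate C₂
      C₄ = rotate C₃

    ∑-received : ∑ (rot q) (λ u → S u q) ≡ received (full q) (cl a) (cl b) (cl c) (cl d) (cl e)
    ∑-received = trans (∑-nbrs (λ u → S u q)) (cong₂ _+_ (S-cycle five C) (cong₂ _+_ (S-cycle five C₁)
      (cong₂ _+_ (S-cycle five C₂) (cong₂ _+_ (S-cycle five C₃) (S-cycle five C₄)))))

    ∑-aidGiven : ∑ (rot q) (Aid q) ≡ aidGiven (cl a) (cl b) (cl c) (cl d) (cl e)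
    ∑-aidGiven = trans (∑-nbrs (Aid q)) (cong₂ _+_ (A-cycle five C) (cong₂ _+_ (A-cycle five C₁)
      (cong₂ _+_ (A-cycle five C₂) (cong₂ _+_ (A-cycle five C₃) (A-cycle five C₄)))))

    -- Each aid is passed on at most once: that of `c` can go only to `a` (by `special⁻`) or to `e`
    -- (by `special⁺`), and these exclude each other.
    ∑-refund : ∑ (rot q) (λ u → refund u q) ≤ ∑ (rot q) (λ u → Aid u q)
    ∑-refund = begin
        ∑ (rot q) (λ u → refund u q)
          ≡⟨ trans (∑-nbrs (λ u → refund u q)) (cong₂ _+_ (refund-cycle five C) (cong₂ _+_ (refund-cycle five C₁)
               (cong₂ _+_ (refund-cycle five C₂) (cong₂ _+_ (refund-cycle five C₃) (refund-cycle five C₄))))) ⟩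
        _
          ≡⟨ regroup (s⁻ a b c d e) (s⁻ b c d e a) (s⁻ c d e a b) (s⁻ d e a b c) (s⁻ e a b c d)
               (s⁺ a b c d e) (s⁺ b c d e a) (s⁺ c d e a b) (s⁺ d e a b c) (s⁺ e a b c d)
               (Aid a q) (Aid b q) (Aid c q) (Aid d q) (Aid e q) ⟩
        (s⁻ d e a b c + s⁺ c d e a b) * Aid a q + ((s⁻ e a b c d + s⁺ d e a b c) * Aid b q
          + ((s⁻ a b c d e + s⁺ e a b c d) * Aid c q + ((s⁻ b c d e a + s⁺ a b c d e) * Aid d q
          + (s⁻ c d e a b + s⁺ b c d e a) * Aid e q)))
          ≤⟨ +-mono-≤ (once d e a b c) (+-mono-≤ (once e a b c d) (+-mono-≤ (once a b c d e)
               (+-mono-≤ (once b c d e a) (once c d e a b)))) ⟩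
        Aid a q + (Aid b q + (Aid c q + (Aid d q + Aid e q)))
          ≡⟨ sym (∑-nbrs (λ u → Aid u q)) ⟩
        ∑ (rot q) (λ u → Aid u q) ∎
      where
      open ≤-Reasoning
      s⁻ s⁺ : W → W → W → W → W → ℕ
      s⁻ a b c d e = ⟦ special⁻ (cl a) (full q) (cl b) (cl c) (cl d) (cl e) ⟧
      s⁺ a b c d e = ⟦ special⁺ (cl a) (full q) (cl b) (cl c) (cl d) (cl e) ⟧
      once : ∀ a b c d e {k} → (s⁻ a b c d e + s⁺ e a b c d) * k ≤ k
      once a b c d e {k} = ≤-trans (*-monoˡ-≤ k (special-exclusive (full q) (cl a) (cl b) (cl c) (cl d) (cl e)))
        (≤-reflexive (*-identityˡ k))
      regroup : ∀ a b c d e a′ b′ c′ d′ e′ p q r s t →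
        (a * r + a′ * s) + ((b * s + b′ * t) + ((c * t + c′ * p) + ((d * p + d′ * q) + (e * q + e′ * r))))
        ≡ (d + c′) * p + ((e + d′) * q + ((a + e′) * r + ((b + a′) * s + (c + b′) * t)))
      regroup = solve-∀

  fromFaces≤ : ∀ q → fromFaces (full q) ≤ 30 * nontriAt q
  fromFaces≤ q with nontriAt q
  ... | zero = z≤n
  ... | suc k = *-monoʳ-≤ 30 (s≤s (z≤n {k}))

  -- The final charge is nonnegative; the 360 = 60·6 stands on the left so that everything stays in
  -- the natural numbers.
  Balanced : W → Set
  Balanced v = 360 + ∑ (rot v) (flow v) ≤ 60 * deg v + 30 * nontriAt v + ∑ (rot v) (λ u → flow u v)

  S-small : ∀ v → major (cl v) ≡ false → ∀ u → S v u ≡ 0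
  S-small v small u with is5 (cl u) | cl v
  ... | false | _ = refl
  ... | true | 5° = refl
  ... | true | 6° = refl

  someNbr : ∀ v → ∃ (_∈ rot v)
  someNbr v with rot v | 5≤deg v
  ... | u ∷ _ | _ = u , here refl

  balanced-5 : ∀ q → cl q ≡ 5° → Balanced q
  balanced-5 q five = begin
      360 + ∑ (rot q) (flow q)
        ≡⟨ cong (360 +_) outgoing ⟩
      360 + (∑ (rot q) (Aid q) + ∑ (rot q) (λ u → refund u q))
        ≤⟨ balance (∑ (rot q) (Aid q)) (nontriAt q) (∑-refund five C) enough ⟩
      60 * 5 + 30 * nontriAt q + (∑ (rot q) (λ u → S u q) + (∑ (rot q) (λ u → Aid u q) + ∑ (rot q) (λ u → refund q u)))
        ≡⟨ cong₂ (λ k l → 60 * k + 30 * nontriAt q + l) (sym (deg≡5 q five)) (sym incoming) ⟩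
      60 * deg q + 30 * nontriAt q + ∑ (rot q) (λ u → flow u q) ∎
    where
    open ≤-Reasoning
    C = cycleAt five (proj₂ (someNbr q))
    z = proj₁ (someNbr q)
    outgoing : ∑ (rot q) (flow q) ≡ ∑ (rot q) (Aid q) + ∑ (rot q) (λ u → refund u q)
    outgoing = trans (∑-cong (rot q) (λ {u} _ → cong (_+ (Aid q u + refund u q)) (S-small q (cong major five) u)))
      (∑-+ (rot q) (Aid q) (λ u → refund u q))
    incoming : ∑ (rot q) (λ u → flow u q)
      ≡ ∑ (rot q) (λ u → S u q) + (∑ (rot q) (λ u → Aid u q) + ∑ (rot q) (λ u → refund q u))
    incoming = trans (∑-+ (rot q) (λ u → S u q) (λ u → Aid u q + refund q u))
      (cong (∑ (rot q) (λ u → S u q) +_) (∑-+ (rot q) (λ u → Aid u q) (λ u → refund q u)))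
    enough : 60 + ∑ (rot q) (Aid q) ≤ 30 * nontriAt q + ∑ (rot q) (λ u → S u q)
    enough = ≤-trans (≤-reflexive (cong (60 +_) (∑-aidGiven five C)))
      (≤-trans (satisfied-or-star (full q) (cl z) (cl (w₁ z q)) (cl (w₂ z q)) (cl (w₃ z q)) (cl (w₄ z q)) (starless C))
      (+-mono-≤ (fromFaces≤ q) (≤-reflexive (sym (∑-received five C)))))
    balance : ∀ g t {r a s b} → r ≤ a → 60 + g ≤ 30 * t + s → 360 + (g + r) ≤ 60 * 5 + 30 * t + (s + (a + b))
    balance g t {r} {a} {s} {b} r≤a paid = begin
        360 + (g + r)                       ≡⟨ split g r ⟩
        300 + ((60 + g) + r)                ≤⟨ +-monoʳ-≤ 300 (+-mono-≤ paid r≤a) ⟩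
        300 + ((30 * t + s) + a)            ≤⟨ m≤m+n _ b ⟩
        300 + ((30 * t + s) + a) + b        ≡⟨ regroup t s a b ⟩
        300 + 30 * t + (s + (a + b))        ∎
      where
      split : ∀ a b → 360 + (a + b) ≡ 300 + ((60 + a) + b)
      split = solve-∀
      regroup : ∀ t a b c → 300 + ((30 * t + a) + b) + c ≡ 300 + 30 * t + (a + (b + c))
      regroup = solve-∀

  balanced-6 : ∀ v → cl v ≡ 6° → Balanced v
  balanced-6 v six = begin
      360 + ∑ (rot v) (flow v)
        ≡⟨ cong (360 +_) (trans (∑-cong (rot v) (λ {u} _ → nothingOut u)) (∑-const (rot v) 0)) ⟩
      60 * 6
        ≡⟨ cong (60 *_) (sym (deg≡6 (cl-correct v))) ⟩
      60 * deg v
        ≤⟨ m≤m+n _ _ ⟩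
      60 * deg v + 30 * nontriAt v
        ≤⟨ m≤m+n _ _ ⟩
      60 * deg v + 30 * nontriAt v + ∑ (rot v) (λ u → flow u v) ∎
    where
    open ≤-Reasoning
    deg≡6 : InClass (cl v) (deg v) → deg v ≡ 6
    deg≡6 c rewrite six with deg v | c
    ... | .6 | in6 = refl
    nothingOut : ∀ u → flow v u ≡ 0
    nothingOut u rewrite S-small v (cong major six) u | six = refl

  -- Triangles around a vertex

  corner : ∀ {a u} → nontri (a , u) ≡ 0 → nx (nx u a) u ≡ a × nx a (nx u a) ≡ u
  corner {a} {u} eq with tri (a , u) in triangular
  ... | true = first , trans (cong (λ v → nx v (nx u a)) (sym first)) (cong proj₂ (tri⇒ (a , u) triangular))
    where
    first : nx (nx u a) u ≡ a
    first = cong proj₁ (tri⇒ (a , u) triangular)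

  full⇒ : ∀ {q} → full q ≡ true → nontriAt q ≡ 0
  full⇒ {q} eq = ≡ᵇ⇒≡ (nontriAt q) 0 (subst T (sym eq) _)

  -- For consecutive neighbours `a` and `b = nx u a` of `u`, the face closes after three steps: `a`
  -- follows `u` around `b`, and `u` follows `b` around `a`.
  triangle : ∀ {a u} → nontriAt u ≡ 0 → a ∈ rot u → nx (nx u a) u ≡ a × nx a (nx u a) ≡ u
  triangle {a} {u} t≡0 a∈ = corner (n≤0⇒n≡0 (subst (nontri (a , u) ≤_) t≡0 (term≤∑ (λ a → nontri (a , u)) a∈)))

  nx-∈ : ∀ {u a} → a ∈ rot u → nx u a ∈ rot u
  nx-∈ {u} = nextIn-∈ (noDup u)

  nx-inj : ∀ {u a b} → a ∈ rot u → b ∈ rot u → nx u a ≡ nx u b → a ≡ b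
  nx-inj {u} = nextIn-injective (noDup u)

  flip : ∀ {u v} → u ∈ rot v → v ∈ rot u
  flip {u} {v} = symmetric u v

  five⇒closes : ∀ {q z} → cl q ≡ 5° → z ∈ rot q → nx q (w₄ z q) ≡ z
  five⇒closes five z∈ = Cycle.e→a (cycleAt five z∈)

  w₄-unique : ∀ {q z a} → cl q ≡ 5° → z ∈ rot q → a ∈ rot q → nx q a ≡ z → w₄ z q ≡ a
  w₄-unique five z∈ a∈ eq = nx-inj (nx-∈ (nx-∈ (nx-∈ (nx-∈ z∈)))) a∈ (trans (five⇒closes five z∈) (sym eq))

  w₃-unique : ∀ {q z a b} → cl q ≡ 5° → z ∈ rot q → a ∈ rot q → nx q a ≡ b → nx q b ≡ z → w₃ z q ≡ a
  w₃-unique five z∈ a∈ refl eq = nx-inj (nx-∈ (nx-∈ (nx-∈ z∈))) a∈ (w₄-unique five z∈ (nx-∈ a∈) eq)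

  -- Around a full 5-vertex q, the neighbours of q next to z are the neighbours of z next to q.
  module Full {z q} (five : cl q ≡ 5°) (fullq : full q ≡ true) (q∈z : q ∈ rot z) where
    private
      z∈q = flip q∈z
      t≡0 = full⇒ {q} fullq

    left : nx (w₁ z q) q ≡ z × nx z (w₁ z q) ≡ q
    left = triangle t≡0 z∈q

    left∈ : w₁ z q ∈ rot z
    left∈ = flip (subst (_∈ rot (w₁ z q)) (proj₁ left) (nx-∈ (flip (nx-∈ z∈q))))

    right : nx z q ≡ w₄ z q × nx (w₄ z q) z ≡ q
    right with (c₁ , c₂) ← triangle t≡0 (nx-∈ (nx-∈ (nx-∈ (nx-∈ z∈q)))) rewrite five⇒closes five z∈q = c₁ , c₂

    w₁≡ : ∀ {p} → p ∈ rot z → nx z p ≡ q → w₁ z q ≡ p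
    w₁≡ p∈ eq = nx-inj left∈ p∈ (trans (proj₂ left) (sym eq))

    -- `q` and its successor `r` see the same vertex across from z: the apex of the second triangle
    -- on their common edge.
    next : ∀ {r} → nx z q ≡ r → w₄ z q ≡ r × w₁ z r ≡ q × w₂ z r ≡ w₃ z q
    next refl = sym (proj₁ right) , same , trans (cong (nx (nx z q)) same)
        (trans (cong (λ v → nx v q) (proj₁ right)) (proj₁ (triangle t≡0 (nx-∈ (nx-∈ (nx-∈ z∈q))))))
      where
      same : nx (nx z q) z ≡ q
      same = trans (cong (λ v → nx v z) (proj₁ right)) (proj₂ right)

    w₄-prev : cl (w₁ z q) ≡ 5° → w₄ z (w₁ z q) ≡ q
    w₄-prev five′ = w₄-unique five′ (flip left∈) (flip (nx-∈ z∈q)) (proj₁ left)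

    w₃-prev : cl (w₁ z q) ≡ 5° → w₃ z (w₁ z q) ≡ w₂ z q
    w₃-prev five′ with (c₁ , c₂) ← triangle t≡0 (nx-∈ z∈q) = w₃-unique five′ (flip left∈)
      (flip (subst (_∈ rot (w₂ z q)) c₁ (nx-∈ (flip (nx-∈ (nx-∈ z∈q)))))) c₂ (proj₁ left)

    -- The mirror image of `next`. Here `w₃` and `w₄` of `p` are found by counting back from `z`,
    -- which takes degree exactly five.
    prev : ∀ {p} → p ∈ rot z → nx z p ≡ q → cl p ≡ 5° → w₁ z q ≡ p × w₄ z p ≡ q × w₃ z p ≡ w₂ z q
    prev p∈ eq five′ with refl ← w₁≡ p∈ eq = refl , w₄-prev five′ , w₃-prev five′

  -- Local inequalities summed around a major vertex

  E : W → ℕ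
  E v = ⟦ big (cl v) ⟧

  bonus≤ : ∀ {z p q} h → cl q ≡ 5° → p ∈ rot z → nx z p ≡ q →
    Bounds.bonus (full q) h (cl (w₁ z q)) (cl (w₄ z q)) ≤ h * (E p + E (nx z q))
  bonus≤ {z} {p} {q} h five p∈ eq with full q in fullq
  ... | false = z≤n
  ... | true = ≤-reflexive (cong₂ (λ a d → h * (E a + E d)) (F.w₁≡ p∈ eq) (sym (proj₁ F.right)))
    where module F = Full {z} {q} five fullq (subst (_∈ rot z) eq (nx-∈ p∈))

  -- Sums around z of inequalities that relate three consecutive neighbours p, nx z p, nx z (nx z p).
  module Around (z : W) (x ω i j : W → ℕ) (k β h : ℕ) where
    L R : W → ℕ
    L p = x (nx z p) + k * E (nx z p) + (i (nx z (nx z p)) + j p)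
    R p = β + h * (E p + E (nx z (nx z p))) + ω (nx z p)

    ∑-around : (W → ℕ) → ℕ
    ∑-around = ∑ (rot z)

    private
      next : ∀ f → ∑-around (f ∘ nx z) ≡ ∑-around f
      next = ∑-next (noDup z)

    ∑-L : ∑-around L ≡ ∑-around x + k * ∑-around E + (∑-around i + ∑-around j)
    ∑-L = trans (∑-+ (rot z) (λ p → x (nx z p) + k * E (nx z p)) (λ p → i (nx z (nx z p)) + j p))
      (cong₂ _+_
        (trans (next (λ p → x p + k * E p)) (trans (∑-+ (rot z) x (λ p → k * E p)) (cong (∑-around x +_) (∑-* (rot z) k E))))
        (trans (∑-+ (rot z) (i ∘ nx z ∘ nx z) j) (cong (_+ ∑-around j) (trans (next (i ∘ nx z)) (next i)))))

    ∑-R : ∑-around R ≡ β * deg z + h * (∑-around E + ∑-around E) + ∑-around ω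
    ∑-R = trans (∑-+ (rot z) (λ p → β + h * (E p + E (nx z (nx z p)))) (ω ∘ nx z))
      (cong₂ _+_
        (trans (∑-+ (rot z) (λ _ → β) (λ p → h * (E p + E (nx z (nx z p)))))
          (cong₂ _+_ (∑-const (rot z) β) (trans (∑-* (rot z) h (λ p → E p + E (nx z (nx z p))))
            (cong (h *_) (trans (∑-+ (rot z) E (E ∘ nx z ∘ nx z))
              (cong (∑-around E +_) (trans (next (E ∘ nx z)) (next E))))))))
        (next ω))

    total : (∀ {p} → p ∈ rot z → L p ≤ R p) →
      ∑-around x + k * ∑-around E + (∑-around i + ∑-around j) ≤ β * deg z + h * (∑-around E + ∑-around E) + ∑-around ω
    total local = subst₂ _≤_ ∑-L ∑-R (∑-mono (rot z) local)

    total-gain : ∀ {p} c → (∀ {p} → p ∈ rot z → L p ≤ R p) → p ∈ rot z → c + L p ≤ R p →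
      ∑-around x + k * ∑-around E + (∑-around i + ∑-around j) + c
        ≤ β * deg z + h * (∑-around E + ∑-around E) + ∑-around ω
    total-gain c local p∈ gap = subst₂ _≤_ (cong (_+ c) ∑-L) ∑-R (∑-gain c local p∈ gap)

  K : W → ℕ
  K z = ∑ (rot z) E

  five? : ∀ q → cl q ≡ 5° ⊎ is5 (cl q) ≡ false
  five? q with is5 (cl q) in eq
  ... | true = inj₁ (is5⇒≡ eq)
  ... | false = inj₂ refl

  S-five : ∀ {z q c} → cl z ≡ c → cl q ≡ 5° →
    S z q ≡ send c (full q) (cl (w₁ z q)) (cl (w₂ z q)) (cl (w₃ z q)) (cl (w₄ z q))
  S-five refl five rewrite five = refl

  S-big : ∀ {z q} → is5 (cl q) ≡ false → S z q ≡ 0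
  S-big eq rewrite eq = refl

  E-five : ∀ {q} → cl q ≡ 5° → E q ≡ 0
  E-five five rewrite five = refl

  E-big : ∀ {q} → is5 (cl q) ≡ false → E q ≡ 1
  E-big eq rewrite big⇒≢5 eq = refl

  local-five : ∀ x k i β g h ω {e} → e ≡ 0 → x + i ≤ β + g + ω → g ≤ h → x + k * e + i ≤ β + h + ω
  local-five x k i β g h ω refl bound g≤h = ≤-trans
    (≤-reflexive (cong (_+ i) (trans (cong (x +_) (*-zeroʳ k)) (+-identityʳ x))))
    (≤-trans bound (+-monoˡ-≤ ω (+-monoʳ-≤ β g≤h)))

  -- A neighbour of degree at least 6 takes nothing and is never charged, so its whole share `k`
  -- counts as saved.
  local-big : ∀ k h ω {x e i} → x ≡ 0 → e ≡ 1 → i ≡ 0 → x + k * e + i ≤ k + h + ω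
  local-big k h ω refl refl refl = ≤-trans
    (≤-reflexive (trans (+-identityʳ _) (*-identityʳ k))) (≤-trans (m≤m+n k h) (m≤m+n (k + h) ω))

  uniform-local : ∀ {z} → Bounds.uniform (cl z) ≡ true → ∀ {p} → p ∈ rot z →
    2 * S z (nx z p) + 2 * Bounds.share (cl z) * E (nx z p) + (0 + 0)
      ≤ 2 * Bounds.share (cl z) + Bounds.share (cl z) * (E p + E (nx z (nx z p))) + 0
  uniform-local {z} ev {p} p∈ with five? (nx z p)
  ... | inj₁ five = local-five (2 * S z q) (2 * b) 0 (2 * b)
        (Bounds.bonus (full q) b (cl (w₁ z q)) (cl (w₄ z q))) (b * (E p + E (nx z q))) 0 (E-five five)
        (subst₂ _≤_ (trans (cong (2 *_) (sym (S-five refl five))) (sym (+-identityʳ _))) (sym (+-identityʳ _))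
          (Bounds.uniform-bound (cl z) (full q) (cl (w₁ z q)) (cl (w₂ z q)) (cl (w₃ z q)) (cl (w₄ z q)) ev))
        (bonus≤ b five p∈ refl)
    where
    q = nx z p
    b = Bounds.share (cl z)
  ... | inj₂ big = local-big (2 * Bounds.share (cl z)) (Bounds.share (cl z) * (E p + E (nx z (nx z p)))) 0
        (cong (2 *_) (S-big big)) (E-big big) refl

  11-local : ∀ {z} → cl z ≡ 11° → ∀ {p} → p ∈ rot z →
    S z (nx z p) + 30 * E (nx z p) + (0 + 0) ≤ 30 + 6 * (E p + E (nx z (nx z p))) + 0
  11-local {z} eleven {p} p∈ with five? (nx z p)
  ... | inj₁ five = local-five (S z q) 30 0 30
        (Bounds.bonus (full q) 6 (cl (w₁ z q)) (cl (w₄ z q))) (6 * (E p + E (nx z q))) 0 (E-five five)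
        (subst₂ _≤_ (trans (sym (S-five eleven five)) (sym (+-identityʳ _))) (sym (+-identityʳ _))
          (Bounds.11-bound (full q) (cl (w₁ z q)) (cl (w₂ z q)) (cl (w₃ z q)) (cl (w₄ z q))))
        (bonus≤ 6 five p∈ refl)
    where q = nx z p
  ... | inj₂ big = local-big 30 (6 * (E p + E (nx z (nx z p)))) 0 (S-big big) (E-big big) refl

  -- Tight neighbours of a vertex of degree 11

  τ⁺ τ⁻ : W → W → Bool
  τ⁺ z q = is5 (cl q) ∧ tight⁺ (full q) (cl (w₁ z q)) (cl (w₂ z q)) (cl (w₃ z q)) (cl (w₄ z q))
  τ⁻ z q = is5 (cl q) ∧ tight⁻ (full q) (cl (w₁ z q)) (cl (w₂ z q)) (cl (w₃ z q)) (cl (w₄ z q))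

  record Tight⁺ (z q : W) : Set where
    field
      five : cl q ≡ 5°
      isFull : full q ≡ true
      first : is6 (cl (w₁ z q)) ≡ true
      third : is10 (cl (w₃ z q)) ≡ true
      fourth : cl (w₄ z q) ≡ 5°

  record Tight⁻ (z q : W) : Set where
    field
      five : cl q ≡ 5°
      isFull : full q ≡ true
      first : cl (w₁ z q) ≡ 5°
      second : is10 (cl (w₂ z q)) ≡ true
      fourth : is6 (cl (w₄ z q)) ≡ true

  τ⁺⇒ : ∀ {z q} → τ⁺ z q ≡ true → Tight⁺ z q
  τ⁺⇒ {z} {q} eq
    with (five , eq) ← ∧-true {is5 (cl q)} eq
    with (isFull , eq) ← ∧-true {full q} eq
    with (first , eq) ← ∧-true {is6 (cl (w₁ z q))} eq
    with (_ , eq) ← ∧-true {is5 (cl (w₂ z q))} eq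
    with (third , fourth) ← ∧-true {is10 (cl (w₃ z q))} eq
    = record { five = is5⇒≡ five ; isFull = isFull ; first = first ; third = third ; fourth = is5⇒≡ fourth }

  τ⁻⇒ : ∀ {z q} → τ⁻ z q ≡ true → Tight⁻ z q
  τ⁻⇒ {z} {q} eq
    with (five , eq) ← ∧-true {is5 (cl q)} eq
    with (isFull , eq) ← ∧-true {full q} eq
    with (first , eq) ← ∧-true {is5 (cl (w₁ z q))} eq
    with (second , eq) ← ∧-true {is10 (cl (w₂ z q))} eq
    with (_ , fourth) ← ∧-true {is5 (cl (w₃ z q))} eq
    = record { five = is5⇒≡ five ; isFull = isFull ; first = is5⇒≡ first ; second = second ; fourth = fourth }

  is6⇒big : ∀ {c} → is6 c ≡ true → big c ≡ true
  is6⇒big {6°} _ = refl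

  -- Two distinct neighbours of z of degree at least 6 are excluded when K z ≤ 1.
  lonely : ∀ {z a b} → K z ≤ 1 → a ∈ rot z → b ∈ rot z → a ≢ b → big (cl a) ≡ true → is5 (cl b) ≡ true
  lonely {z} {a} {b} K≤1 a∈ b∈ a≢b bigA with five? b
  ... | inj₁ five = cong is5 five
  ... | inj₂ bigB with s≤s () ← ≤-trans (subst (_≤ K z) (cong₂ _+_ (cong ⟦_⟧ bigA) (E-big bigB)) (two-terms≤∑ E a∈ b∈ a≢b)) K≤1

  -- The 6-neighbour of the tight vertex `p` precedes it around z, so the charge goes forward to
  -- `q`, which sees the same 10-vertex across from z.
  τ⁺-prev : ∀ {z p q} → p ∈ rot z → nx z p ≡ q → τ⁺ z p ≡ true →
    cl q ≡ 5° × w₁ z q ≡ p × is10 (cl (w₂ z q)) ≡ true × w₁ z p ∈ rot z × nx z (w₁ z p) ≡ p × big (cl (w₁ z p)) ≡ true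
  τ⁺-prev {z} {p} p∈ eq t = let (e₄ , e₁ , e₂) = F.next eq in
    trans (cong cl (sym e₄)) (Tight⁺.fourth T⁺) , e₁ , trans (cong (is10 ∘ cl) e₂) (Tight⁺.third T⁺)
    , F.left∈ , proj₂ F.left , is6⇒big (Tight⁺.first T⁺)
    where
    T⁺ = τ⁺⇒ {z} {p} t
    module F = Full {z} {p} (Tight⁺.five T⁺) (Tight⁺.isFull T⁺) p∈

  τ⁻-next : ∀ {z q r} → q ∈ rot z → nx z q ≡ r → τ⁻ z r ≡ true →
    cl q ≡ 5° × w₄ z q ≡ r × is10 (cl (w₃ z q)) ≡ true × big (cl (nx z r)) ≡ true
  τ⁻-next {z} {q} {r} q∈ refl t = let (e₁ , e₄ , e₃) = F.prev q∈ refl five in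
    five , e₄ , trans (cong (is10 ∘ cl) e₃) (Tight⁻.second T⁻)
    , trans (cong (big ∘ cl) (proj₁ F.right)) (is6⇒big (Tight⁻.fourth T⁻))
    where
    T⁻ = τ⁻⇒ {z} {r} t
    module F = Full {z} {r} (Tight⁻.five T⁻) (Tight⁻.isFull T⁻) (nx-∈ q∈)
    five = trans (cong cl (sym (F.w₁≡ q∈ refl))) (Tight⁻.first T⁻)

  excluded : ∀ {b q} → is5 (cl q) ≡ false → (b ≡ true → cl q ≡ 5°) → b ≡ false
  excluded {false} _ _ = refl
  excluded {true} bigQ h with () ← trans (sym bigQ) (cong is5 (h refl))

  tight-local : ∀ {z} → cl z ≡ 11° → 4 ≤ deg z → K z ≤ 1 → ∀ {p} → p ∈ rot z →
    S z (nx z p) + 30 * E (nx z p) + (6 * ⟦ τ⁻ z (nx z (nx z p)) ⟧ + 6 * ⟦ τ⁺ z p ⟧)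
      ≤ 30 + 0 * (E p + E (nx z (nx z p))) + (6 * ⟦ τ⁺ z (nx z p) ⟧ + 6 * ⟦ τ⁻ z (nx z p) ⟧)
  tight-local {z} eleven 4≤ K≤1 {p} p∈ = bound (five? q)
    where
    q = nx z p
    r = nx z q
    q∈ = nx-∈ p∈
    r∈ = nx-∈ q∈
    incoming = 6 * ⟦ τ⁻ z r ⟧ + 6 * ⟦ τ⁺ z p ⟧
    outgoing = 6 * ⟦ τ⁺ z q ⟧ + 6 * ⟦ τ⁻ z q ⟧
    bound : cl q ≡ 5° ⊎ is5 (cl q) ≡ false →
      S z q + 30 * E q + incoming ≤ 30 + 0 * (E p + E r) + outgoing
    bound (inj₂ bigQ) = local-big 30 (0 * (E p + E r)) outgoing (S-big bigQ) (E-big bigQ)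
      (cong₂ (λ a b → 6 * ⟦ a ⟧ + 6 * ⟦ b ⟧)
        (excluded bigQ (λ t → proj₁ (τ⁻-next q∈ refl t))) (excluded bigQ (λ t → proj₁ (τ⁺-prev p∈ refl t))))
    bound (inj₁ five) = local-five (S z q) 30 incoming 30 0 (0 * (E p + E r)) outgoing (E-five five)
      (subst₂ _≤_
        (cong₂ _+_ (sym (S-five eleven five))
          (+-comm (6 * ⟦ τ⁺ z p ⟧) (6 * ⟦ τ⁻ z r ⟧)))
        (cong₂ (λ a b → 30 + (6 * ⟦ a ⟧ + 6 * ⟦ b ⟧)) (τ-five (tight⁺ (full q) (cl (w₁ z q)) (cl (w₂ z q)) (cl (w₃ z q)) (cl (w₄ z q))))
          (τ-five (tight⁻ (full q) (cl (w₁ z q)) (cl (w₂ z q)) (cl (w₃ z q)) (cl (w₄ z q)))))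
        (Bounds.tight-bound (full q) (τ⁺ z p) (τ⁻ z r) (cl (w₁ z q)) (cl (w₂ z q)) (cl (w₃ z q)) (cl (w₄ z q))
          (subst (λ c → star c (cl (w₁ z q)) (cl (w₂ z q)) (cl (w₃ z q)) (cl (w₄ z q)) ≡ false) eleven
            (starless (cycleAt five (flip q∈))))
          (∧-intro (⇒-intro from-p) (⇒-intro from-r))))
      ≤-refl
      where
      τ-five : ∀ b → b ≡ is5 (cl q) ∧ b
      τ-five b rewrite five = refl
      from-p : τ⁺ z p ≡ true → is5 (cl (w₁ z q)) ∧ is10 (cl (w₂ z q)) ∧ (full q ⇒ is5 (cl (w₄ z q))) ≡ true
      from-p t with (_ , e₁ , ten , a∈ , a→p , bigA) ← τ⁺-prev p∈ refl t =
        ∧-intro (cong is5 (trans (cong cl e₁) (Tight⁺.five (τ⁺⇒ {z} {p} t)))) (∧-intro ten (⇒-intro (λ fullq →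
          subst (λ v → is5 (cl v) ≡ true) (proj₁ (Full.right {z} {q} five fullq q∈))
            (lonely K≤1 a∈ r∈ (λ a≡r → nextIn³≢ (noDup z) a∈ 4≤
              (trans (cong (λ v → nx z (nx z v)) a→p) (sym a≡r))) bigA))))
      from-r : τ⁻ z r ≡ true → is5 (cl (w₄ z q)) ∧ is10 (cl (w₃ z q)) ∧ (full q ⇒ is5 (cl (w₁ z q))) ≡ true
      from-r t with (_ , e₄ , ten , bigR) ← τ⁻-next q∈ refl t =
        ∧-intro (cong is5 (trans (cong cl e₄) (Tight⁻.five (τ⁻⇒ {z} {r} t)))) (∧-intro ten (⇒-intro (λ fullq →
          subst (λ v → is5 (cl v) ≡ true) (sym (Full.w₁≡ {z} {q} five fullq q∈ p∈ refl))
            (lonely K≤1 (nx-∈ r∈) p∈ (nextIn³≢ (noDup z) p∈ 4≤) bigR))))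

  -- Special neighbours of a vertex of degree 13 to 17

  -- Special and not refunded: a refund, if any, is 6.
  u⁻ u⁺ : W → W → Bool
  u⁻ z q = σ⁻ z q ∧ (Aid (w₂ z q) q ≤ᵇ 2)
  u⁺ z q = σ⁺ z q ∧ (Aid (w₃ z q) q ≤ᵇ 2)

  record Special⁻ (z q : W) : Set where
    field
      five : cl q ≡ 5°
      isFull : full q ≡ true
      first : cl (w₁ z q) ≡ 5°
      second : cl (w₂ z q) ≡ 5°
      third : cl (w₃ z q) ≡ 10°
      fourth : cl (w₄ z q) ≡ 5°

  record Special⁺ (z q : W) : Set where
    field
      five : cl q ≡ 5°
      isFull : full q ≡ true
      first : cl (w₁ z q) ≡ 5°
      second : cl (w₂ z q) ≡ 10°
      third : cl (w₃ z q) ≡ 5°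
      fourth : cl (w₄ z q) ≡ 5°

  σ⁻⇒ : ∀ {z q} → σ⁻ z q ≡ true → Special⁻ z q
  σ⁻⇒ {z} {q} eq
    with (five , eq) ← ∧-true {is5 (cl q)} eq
    with (_ , eq) ← ∧-true {is13-17 (cl z)} eq
    with (isFull , eq) ← ∧-true {full q} eq
    with (first , eq) ← ∧-true {is5 (cl (w₁ z q))} eq
    with (second , eq) ← ∧-true {is5 (cl (w₂ z q))} eq
    with (third , fourth) ← ∧-true {is10 (cl (w₃ z q))} eq
    = record { five = is5⇒≡ five ; isFull = isFull ; first = is5⇒≡ first ; second = is5⇒≡ second
             ; third = is10⇒≡ third ; fourth = is5⇒≡ fourth }

  σ⁺⇒ : ∀ {z q} → σ⁺ z q ≡ true → Special⁺ z q
  σ⁺⇒ {z} {q} eq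
    with (five , eq) ← ∧-true {is5 (cl q)} eq
    with (_ , eq) ← ∧-true {is13-17 (cl z)} eq
    with (isFull , eq) ← ∧-true {full q} eq
    with (first , eq) ← ∧-true {is5 (cl (w₁ z q))} eq
    with (second , eq) ← ∧-true {is10 (cl (w₂ z q))} eq
    with (third , fourth) ← ∧-true {is5 (cl (w₃ z q))} eq
    = record { five = is5⇒≡ five ; isFull = isFull ; first = is5⇒≡ first ; second = is10⇒≡ second
             ; third = is5⇒≡ third ; fourth = is5⇒≡ fourth }

  A-at : ∀ {m w} → cl m ≡ 5° → w ∈ rot m →
    Aid m w ≡ aid (cl w) (cl (w₁ w m)) (cl (w₂ w m)) (cl (w₃ w m)) (cl (w₄ w m))
  A-at five w∈ = A-cycle five (cycleAt five w∈)

  unrefunded : ∀ {b k} → b ∧ (k ≤ᵇ 2) ≡ true → k ≢ 6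
  unrefunded {true} () refl

  not-10 : ∀ {c} → c ≢ 10° → is10 c ≡ false
  not-10 {c} c≢ with is10 c in eq
  ... | true = ⊥-elim (c≢ (is10⇒≡ eq))
  ... | false = refl

  -- Around `m = w₂ z r` the vertices `w₃ z r`, `r`, `q`, `w₂ z q` are consecutive when `q` is full.
  -- If the last had degree 10 like the first, `m` would aid `r`, and `r` would refund z.
  u⁻-next : ∀ {z q r} → q ∈ rot z → nx z q ≡ r → u⁻ z r ≡ true →
    cl q ≡ 5° × w₄ z q ≡ r × cl (w₃ z q) ≡ 5° × (full q ≡ true → is10 (cl (w₂ z q)) ≡ false)
  u⁻-next {z} {q} {r} q∈ refl u = five , e₄ , trans (cong cl e₃) second , λ fullq → not-10 (λ ten →
      unrefunded {σ⁻ z r} u (trans (A-at second (flip m∈r)) (aid-after (Special⁻.five T⁻)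
        (trans (cong cl (proj₁ q-corner)) first) (trans (cong cl (w₂-of-m fullq)) ten)
        (trans (cong cl last) third))))
    where
    T⁻ = σ⁻⇒ {z} {r} (proj₁ (∧-true {σ⁻ z r} u))
    open Special⁻ T⁻ using (isFull; first; second; third)
    module F = Full {z} {r} (Special⁻.five T⁻) isFull (nx-∈ q∈)
    e₁ = F.w₁≡ q∈ refl
    five = trans (cong cl (sym e₁)) first
    e₄ = proj₁ (proj₂ (F.prev q∈ refl five))
    e₃ = proj₂ (proj₂ (F.prev q∈ refl five))
    m = w₂ z r
    z∈r = flip (nx-∈ q∈)
    m∈r : m ∈ rot r
    m∈r = nx-∈ (nx-∈ z∈r)
    q-corner : nx m r ≡ w₁ z r × nx (w₁ z r) m ≡ r
    q-corner = triangle (full⇒ {r} isFull) (nx-∈ z∈r)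
    m-corner : nx (w₃ z r) r ≡ m × nx m (w₃ z r) ≡ r
    m-corner = triangle (full⇒ {r} isFull) m∈r
    last : w₄ r m ≡ w₃ z r
    last = w₄-unique second (flip m∈r)
      (flip (subst (_∈ rot (w₃ z r)) (proj₁ m-corner) (nx-∈ (flip (nx-∈ m∈r))))) (proj₂ m-corner)
    w₂-of-m : full q ≡ true → w₂ r m ≡ w₂ z q
    w₂-of-m fullq = trans (cong₂ nx (sym e₃) (trans (proj₁ q-corner) e₁))
      (proj₁ (triangle (full⇒ {q} fullq) (nx-∈ (nx-∈ (flip q∈)))))

  u⁺-prev : ∀ {z p q} → p ∈ rot z → nx z p ≡ q → u⁺ z p ≡ true →
    cl q ≡ 5° × w₁ z q ≡ p × cl (w₂ z q) ≡ 5° × (full q ≡ true → is10 (cl (w₃ z q)) ≡ false)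
  u⁺-prev {z} {p} {q} p∈ refl u = trans (cong cl (sym e₄)) fourth , e₁ , trans (cong cl e₂) third , λ fullq →
      not-10 (λ ten → unrefunded {σ⁺ z p} u (trans (A-at third (flip m∈p)) (aid-before (Special⁺.five T⁺)
        (trans (cong cl (proj₁ y-corner)) second) (trans (cong cl (w₃-of-m fullq)) ten)
        (trans (cong cl last) fourth))))
    where
    T⁺ = σ⁺⇒ {z} {p} (proj₁ (∧-true {σ⁺ z p} u))
    open Special⁺ T⁺ using (isFull; second; third; fourth)
    module F = Full {z} {p} (Special⁺.five T⁺) isFull p∈
    e₄ = proj₁ (F.next refl)
    e₁ = proj₁ (proj₂ (F.next refl))
    e₂ = proj₂ (proj₂ (F.next refl))
    m = w₃ z p
    y∈p : w₂ z p ∈ rot p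
    y∈p = nx-∈ (nx-∈ (flip p∈))
    m∈p : m ∈ rot p
    m∈p = nx-∈ y∈p
    y-corner : nx m p ≡ w₂ z p × nx (w₂ z p) m ≡ p
    y-corner = triangle (full⇒ {p} isFull) y∈p
    m-corner : nx (w₄ z p) p ≡ m × nx m (w₄ z p) ≡ p
    m-corner = triangle (full⇒ {p} isFull) m∈p
    w₄∈m : w₄ z p ∈ rot m
    w₄∈m = flip (subst (_∈ rot (w₄ z p)) (proj₁ m-corner) (nx-∈ (flip (nx-∈ m∈p))))
    last : w₄ p m ≡ w₄ z p
    last = w₄-unique third (flip m∈p) w₄∈m (proj₂ m-corner)
    w₃-of-m : full q ≡ true → w₃ p m ≡ w₃ z q
    w₃-of-m fullq = w₃-unique third (flip m∈p)
      (subst (λ v → w₃ z q ∈ rot v) e₂ (flip (subst (_∈ rot (w₃ z q)) (proj₁ c) (nx-∈ (flip (nx-∈ m∈q))))))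
      (trans (cong (λ v → nx v (w₃ z q)) (sym e₂)) (proj₂ c))
      (trans (cong (nx m) (sym e₄)) (proj₂ m-corner))
      where
      m∈q : w₂ z q ∈ rot q
      m∈q = nx-∈ (nx-∈ (flip (nx-∈ p∈)))
      c : nx (w₃ z q) q ≡ w₂ z q × nx (w₂ z q) (w₃ z q) ≡ q
      c = triangle (full⇒ {q} fullq) m∈q

  -- In doubled units a refund of 3 already covers the excess 6. The threshold 2 thus works for
  -- every `k`, and the possible values of `aid` need not be listed.
  reimburse : ∀ b k → 6 * ⟦ b ⟧ ≤ 6 * ⟦ b ∧ (k ≤ᵇ 2) ⟧ + 2 * (⟦ b ⟧ * k)
  reimburse false k = z≤n
  reimburse true 0 = m≤m+n 6 0
  reimburse true 1 = m≤m+n 6 2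
  reimburse true 2 = m≤m+n 6 4
  reimburse true (suc (suc (suc k))) = *-monoʳ-≤ 2 {3} (m≤m+n 3 (k + 0))

  spare : W → W → ℕ
  spare z q = (6 * ⟦ u⁻ z q ⟧ + 6 * ⟦ u⁺ z q ⟧) + 2 * refund z q

  spare≥ : ∀ {z q} → cl z ≡ 13-17° → cl q ≡ 5° →
    6 * (⟦ special⁻ 13-17° (full q) (cl (w₁ z q)) (cl (w₂ z q)) (cl (w₃ z q)) (cl (w₄ z q)) ⟧
       + ⟦ special⁺ 13-17° (full q) (cl (w₁ z q)) (cl (w₂ z q)) (cl (w₃ z q)) (cl (w₄ z q)) ⟧) ≤ spare z q
  spare≥ {z} {q} big-z five = begin
      6 * (⟦ special⁻ 13-17° (full q) (cl (w₁ z q)) (cl (w₂ z q)) (cl (w₃ z q)) (cl (w₄ z q)) ⟧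
       + ⟦ special⁺ 13-17° (full q) (cl (w₁ z q)) (cl (w₂ z q)) (cl (w₃ z q)) (cl (w₄ z q)) ⟧)
        ≡⟨ cong₂ (λ a b → 6 * (⟦ a ⟧ + ⟦ b ⟧)) σ⁻≡ σ⁺≡ ⟩
      6 * (⟦ σ⁻ z q ⟧ + ⟦ σ⁺ z q ⟧)
        ≡⟨ *-distribˡ-+ 6 ⟦ σ⁻ z q ⟧ ⟦ σ⁺ z q ⟧ ⟩
      6 * ⟦ σ⁻ z q ⟧ + 6 * ⟦ σ⁺ z q ⟧
        ≤⟨ +-mono-≤ (reimburse (σ⁻ z q) (Aid (w₂ z q) q)) (reimburse (σ⁺ z q) (Aid (w₃ z q) q)) ⟩
      (6 * ⟦ u⁻ z q ⟧ + 2 * (⟦ σ⁻ z q ⟧ * Aid (w₂ z q) q)) + (6 * ⟦ u⁺ z q ⟧ + 2 * (⟦ σ⁺ z q ⟧ * Aid (w₃ z q) q))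
        ≡⟨ regroup (6 * ⟦ u⁻ z q ⟧) (⟦ σ⁻ z q ⟧ * Aid (w₂ z q) q) (6 * ⟦ u⁺ z q ⟧) (⟦ σ⁺ z q ⟧ * Aid (w₃ z q) q) ⟩
      spare z q ∎
    where
    open ≤-Reasoning
    regroup : ∀ a b c d → (a + 2 * b) + (c + 2 * d) ≡ (a + c) + 2 * (b + d)
    regroup = solve-∀
    σ⁻≡ : special⁻ 13-17° (full q) (cl (w₁ z q)) (cl (w₂ z q)) (cl (w₃ z q)) (cl (w₄ z q)) ≡ σ⁻ z q
    σ⁻≡ rewrite five | big-z = refl
    σ⁺≡ : special⁺ 13-17° (full q) (cl (w₁ z q)) (cl (w₂ z q)) (cl (w₃ z q)) (cl (w₄ z q)) ≡ σ⁺ z q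
    σ⁺≡ rewrite five | big-z = refl

  special-local : ∀ two {z} → cl z ≡ 13-17° → (two ≡ false → K z ≤ 1) → ∀ {p} → p ∈ rot z →
    2 * S z (nx z p) + 66 * E (nx z p) + (6 * ⟦ u⁻ z (nx z (nx z p)) ⟧ + 6 * ⟦ u⁺ z p ⟧)
      ≤ 66 + Bounds.perSide two * (E p + E (nx z (nx z p))) + spare z (nx z p)
  special-local two {z} big-z oneBig {p} p∈ = bound (five? q)
    where
    q = nx z p
    r = nx z q
    q∈ = nx-∈ p∈
    r∈ = nx-∈ q∈
    h = Bounds.perSide two
    incoming = 6 * ⟦ u⁻ z r ⟧ + 6 * ⟦ u⁺ z p ⟧
    bound : cl q ≡ 5° ⊎ is5 (cl q) ≡ false →
      2 * S z q + 66 * E q + incoming ≤ 66 + h * (E p + E r) + spare z q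
    bound (inj₂ bigQ) = local-big 66 (h * (E p + E r)) (spare z q) (cong (2 *_) (S-big bigQ)) (E-big bigQ)
      (cong₂ (λ a b → 6 * ⟦ a ⟧ + 6 * ⟦ b ⟧)
        (excluded bigQ (λ u → proj₁ (u⁻-next q∈ refl u))) (excluded bigQ (λ u → proj₁ (u⁺-prev p∈ refl u))))
    bound (inj₁ five) = local-five (2 * S z q) 66 incoming 66 bonus (h * (E p + E r)) (spare z q) (E-five five)
      (≤-trans (≤-reflexive double) (≤-trans
        (Bounds.special-bound two (full q) (u⁻ z r) (u⁺ z p) (cl (w₁ z q)) (cl (w₂ z q)) (cl (w₃ z q)) (cl (w₄ z q))
          (subst (λ c → star c (cl (w₁ z q)) (cl (w₂ z q)) (cl (w₃ z q)) (cl (w₄ z q)) ≡ false) big-z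
            (starless (cycleAt five (flip q∈))))
          (⇒-intro sided) (∧-intro (⇒-intro from-r) (⇒-intro from-p)))
        (+-monoʳ-≤ (66 + bonus) (spare≥ big-z five))))
      (bonus≤ h five p∈ refl)
      where
      bonus = Bounds.bonus (full q) h (cl (w₁ z q)) (cl (w₄ z q))
      sent = send 13-17° (full q) (cl (w₁ z q)) (cl (w₂ z q)) (cl (w₃ z q)) (cl (w₄ z q))
      double : 2 * S z q + incoming ≡ 2 * (sent + (3 * ⟦ u⁻ z r ⟧ + 3 * ⟦ u⁺ z p ⟧))
      double = trans (cong (λ s → 2 * s + incoming) (S-five big-z five)) (arith sent ⟦ u⁻ z r ⟧ ⟦ u⁺ z p ⟧)
        where
        arith : ∀ s a b → 2 * s + (6 * a + 6 * b) ≡ 2 * (s + (3 * a + 3 * b))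
        arith = solve-∀
      sided : Bounds.twoSided (full q) (cl (w₁ z q)) (cl (w₄ z q)) ≡ true → two ≡ true
      sided eq with (fullq , bigs) ← ∧-true {full q} eq
        with (bigP , bigR) ← ∧-true {big (cl (w₁ z q))} bigs = ¬-not (λ two≡false → disagree
          (trans (sym (cong not (subst (λ v → big (cl v) ≡ true) (sym (proj₁ (Full.right {z} {q} five fullq q∈))) bigR)))
            (lonely (oneBig two≡false) p∈ r∈ (λ p≡r → nextIn²≢ (noDup z) p∈ (≤-trans (m≤m+n 3 2) (5≤deg z)) (sym p≡r))
              (subst (λ v → big (cl v) ≡ true) (Full.w₁≡ {z} {q} five fullq q∈ p∈ refl) bigP))))
        where
        disagree : false ≢ true
        disagree ()
      from-r : u⁻ z r ≡ true → is5 (cl (w₄ z q)) ∧ is5 (cl (w₃ z q)) ∧ (full q ⇒ not (is10 (cl (w₂ z q)))) ≡ true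
      from-r u with (_ , e₄ , c₃ , c₂) ← u⁻-next q∈ refl u =
        ∧-intro (cong is5 (trans (cong cl e₄) (Special⁻.five (σ⁻⇒ {z} {r} (proj₁ (∧-true {σ⁻ z r} u))))))
          (∧-intro (cong is5 c₃) (⇒-intro (λ fullq → cong not (c₂ fullq))))
      from-p : u⁺ z p ≡ true → is5 (cl (w₁ z q)) ∧ is5 (cl (w₂ z q)) ∧ (full q ⇒ not (is10 (cl (w₃ z q)))) ≡ true
      from-p u with (_ , e₁ , c₂ , c₃) ← u⁺-prev p∈ refl u =
        ∧-intro (cong is5 (trans (cong cl e₁) (Special⁺.five (σ⁺⇒ {z} {p} (proj₁ (∧-true {σ⁺ z p} u))))))
          (∧-intro (cong is5 c₂) (⇒-intro (λ fullq → cong not (c₃ fullq))))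

  -- Parity at a vertex with 5-neighbours only

  true≢false : true ≢ false
  true≢false ()

  ∨-false : ∀ {a b} → a ∨ b ≡ false → a ≡ false × b ≡ false
  ∨-false {false} {false} _ = refl , refl

  xor : ∀ x y → y ∧ x ≡ false → (x ≡ false → y ≡ false → ⊥) → ⟦ x ⟧ + ⟦ y ⟧ ≡ 1
  xor true false _ _ = refl
  xor false true _ _ = refl
  xor false false _ notBoth = ⊥-elim (notBoth refl refl)

  eitherFull : ∀ {P : Set} a b → not a ∧ not b ≡ false → (a ≡ true → P) → (b ≡ true → P) → P
  eitherFull true _ _ f _ = f refl
  eitherFull false true _ _ g = g refl

  module NoBig {z} (t≡0 : nontriAt z ≡ 0) (K≡0 : K z ≡ 0) where
    nbr-five : ∀ {q} → q ∈ rot z → cl q ≡ 5°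
    nbr-five {q} q∈ with five? q
    ... | inj₁ five = five
    ... | inj₂ bigQ with () ← subst₂ _≤_ (E-big bigQ) K≡0 (term≤∑ E q∈)

    E≡0 : ∀ {q} → q ∈ rot z → E q ≡ 0
    E≡0 q∈ = E-five (nbr-five q∈)

    w₁-nx : ∀ {p} → p ∈ rot z → w₁ z (nx z p) ≡ p
    w₁-nx p∈ = proj₁ (triangle t≡0 p∈)

    w₄-nx : ∀ {q} → q ∈ rot z → w₄ z q ≡ nx z q
    w₄-nx {q} q∈ = w₄-unique (nbr-five q∈) (flip q∈)
      (flip (subst (_∈ rot (nx z q)) (proj₁ (triangle t≡0 q∈)) (nx-∈ (flip (nx-∈ q∈))))) (proj₂ (triangle t≡0 q∈))

    sides : ∀ {p b} → p ∈ rot z → b ≡ true → is5 (cl (w₁ z (nx z p))) ∧ is5 (cl (w₄ z (nx z p))) ∧ b ≡ true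
    sides p∈ b = ∧-intro (cong is5 (trans (cong cl (w₁-nx p∈)) (nbr-five p∈)))
      (∧-intro (cong is5 (trans (cong cl (w₄-nx (nx-∈ p∈))) (nbr-five (nx-∈ (nx-∈ p∈))))) b)

    -- `X q` and `Y q` concern the opposite vertex on the side of the successor and of the
    -- predecessor of `q`. `thrifty p` speaks of the two neighbours after `p`, to match the
    -- inequalities around z.
    X Y thrifty : W → Bool
    X q = major (cl (w₃ z q))
    Y q = major (cl (w₂ z q))
    thrifty p = (Y (nx z p) ∧ X (nx z p)) ∨ (not (full (nx z p)) ∧ not (full (nx z (nx z p))))

    module _ {p} (p∈ : p ∈ rot z) (none : thrifty p ≡ false) where
      private
        q = nx z p
        q∈ = nx-∈ p∈
        r = nx z q
        halves = ∨-false {Y q ∧ X q} none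

      someMajor : X q ≡ false → Y q ≡ false → ⊥
      someMajor x y = true≢false (trans (sym (Bounds.major-opposite (cl z) (cl (w₁ z q)) (cl (w₂ z q)) (cl (w₃ z q)) (cl (w₄ z q))
        (sides p∈ (∧-intro {not (Y q)} (cong not y) (cong not x))))) (starless (cycleAt (nbr-five q∈) (flip q∈))))

      exactlyOne : ⟦ X q ⟧ + ⟦ Y q ⟧ ≡ 1
      exactlyOne = xor (X q) (Y q) (proj₁ halves) someMajor

      -- As soon as `q` or `r` is full, the edge between them has a triangle on the far side from z,
      -- whose apex is opposite to z at both.
      agree : Y r ≡ X q
      agree = eitherFull (full q) (full r) (proj₂ halves)
        (λ fullq → cong (major ∘ cl) (proj₂ (proj₂ (Full.next {z} {q} (nbr-five q∈) fullq q∈ refl))))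
        (λ fullr → cong (major ∘ cl)
          (sym (proj₂ (proj₂ (Full.prev {z} {r} (nbr-five (nx-∈ q∈)) fullr (nx-∈ q∈) q∈ refl (nbr-five q∈))))))

    -- Otherwise the vertices opposite to z would alternate between major and minor.
    parity : (∀ k → k + k ≢ deg z) → ∃ λ p → p ∈ rot z × thrifty p ≡ true
    parity isOdd with Any.any? (λ p → thrifty p Bool.≟ true) (rot z)
    ... | yes found = find found
    -- `X` and `Y` add up to 1 at each neighbour, and `X q` is `Y` of the successor, so their sums
    -- agree and the degree is twice the sum of `Y`.
    ... | no none = ⊥-elim (isOdd (∑ (rot z) (⟦_⟧ ∘ Y)) (sym (begin
          deg z
            ≡⟨ length-∑ (rot z) ⟩
          ∑ (rot z) (λ _ → 1)
            ≡⟨ ∑-cong (rot z) (λ p∈ → sym (exactlyOne p∈ (unthrifty p∈))) ⟩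
          ∑ (rot z) (λ p → ⟦ X (nx z p) ⟧ + ⟦ Y (nx z p) ⟧)
            ≡⟨ ∑-+ (rot z) (⟦_⟧ ∘ X ∘ nx z) (⟦_⟧ ∘ Y ∘ nx z) ⟩
          ∑ (rot z) (⟦_⟧ ∘ X ∘ nx z) + ∑ (rot z) (⟦_⟧ ∘ Y ∘ nx z)
            ≡⟨ cong₂ _+_ (∑-cong (rot z) (λ p∈ → cong ⟦_⟧ (sym (agree p∈ (unthrifty p∈))))) (∑-next (noDup z) (⟦_⟧ ∘ Y)) ⟩
          ∑ (rot z) (⟦_⟧ ∘ Y ∘ nx z ∘ nx z) + ∑ (rot z) (⟦_⟧ ∘ Y)
            ≡⟨ cong (_+ ∑ (rot z) (⟦_⟧ ∘ Y)) (trans (∑-next (noDup z) (⟦_⟧ ∘ Y ∘ nx z)) (∑-next (noDup z) (⟦_⟧ ∘ Y))) ⟩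
          ∑ (rot z) (⟦_⟧ ∘ Y) + ∑ (rot z) (⟦_⟧ ∘ Y) ∎)))
      where
      open ≡-Reasoning
      unthrifty : ∀ {p} → p ∈ rot z → thrifty p ≡ false
      unthrifty p∈ = ¬-not (All.lookup (¬Any⇒All¬ (rot z) none) p∈)

    S-nonfull : ∀ {p} → parityClass (cl z) ≡ true → p ∈ rot z → full (nx z p) ≡ false → S z (nx z p) ≤ 15
    S-nonfull {p} oddz p∈ notFull = ≤-trans (≤-reflexive (trans (S-five refl (nbr-five (nx-∈ p∈)))
        (cong (λ f → send (cl z) f (cl (w₁ z q)) (cl (w₂ z q)) (cl (w₃ z q)) (cl (w₄ z q))) notFull)))
      (send-nonfull (cl z) (cl (w₁ z q)) (cl (w₂ z q)) (cl (w₃ z q)) (cl (w₄ z q)) oddz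
        (trans (sym (cong (is5 (cl (w₁ z q)) ∧_) (Bool.∧-identityʳ _))) (sides p∈ refl)))
      where q = nx z p

    S-thrifty : ∀ {p} → parityClass (cl z) ≡ true → p ∈ rot z → thrifty p ≡ true →
      S z (nx z p) ≡ 0 ⊎ S z (nx z p) ≤ 15 × S z (nx z (nx z p)) ≤ 15
    S-thrifty {p} oddz p∈ t with ∨-true {Y (nx z p) ∧ X (nx z p)} t
    ... | inj₁ majors = inj₁ (trans (S-five refl (nbr-five (nx-∈ p∈)))
          (send-between-majors (cl z) (full q) (cl (w₁ z q)) (cl (w₂ z q)) (cl (w₃ z q)) (cl (w₄ z q)) oddz (sides p∈ majors)))
      where q = nx z p
    ... | inj₂ nonfull with (q-nonfull , r-nonfull) ← ∧-true {not (full (nx z p))} nonfull =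
      inj₂ (S-nonfull oddz p∈ (Bool.not-injective q-nonfull) , S-nonfull oddz (nx-∈ p∈) (Bool.not-injective r-nonfull))

  -- Solvency of the major vertices

  Solvent : W → Set
  Solvent z = 360 + ∑ (rot z) (S z) ≤ 60 * deg z + 30 * nontriAt z + ∑ (rot z) (λ u → refund z u)

  solvent⇒balanced : ∀ z → major (cl z) ≡ true → Solvent z → Balanced z
  solvent⇒balanced z majorz solvent = begin
      360 + ∑ (rot z) (flow z)
        ≡⟨ cong (360 +_) (∑-cong (rot z) (λ {u} _ → onlyS u)) ⟩
      360 + ∑ (rot z) (S z)
        ≤⟨ solvent ⟩
      60 * deg z + 30 * nontriAt z + ∑ (rot z) (λ u → refund z u)
        ≤⟨ +-monoʳ-≤ (60 * deg z + 30 * nontriAt z) (∑-mono (rot z) (λ {u} _ →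
             ≤-trans (m≤n+m (refund z u) (Aid u z)) (m≤n+m (Aid u z + refund z u) (S u z)))) ⟩
      60 * deg z + 30 * nontriAt z + ∑ (rot z) (λ u → flow u z) ∎
    where
    open ≤-Reasoning
    major⇒big : ∀ {c} → major c ≡ true → is5 c ≡ false
    major⇒big {5°} ()
    major⇒big {6°} ()
    major⇒big {9°} _ = refl
    major⇒big {10°} _ = refl
    major⇒big {11°} _ = refl
    major⇒big {12°} _ = refl
    major⇒big {13-17°} _ = refl
    major⇒big {18+°} _ = refl
    onlyS : ∀ u → flow z u ≡ S z u
    onlyS u rewrite major⇒big majorz = +-identityʳ _

  ∑-zero : ∀ z → ∑ (rot z) (λ _ → 0) ≡ 0
  ∑-zero z = ∑-const (rot z) 0

  solvent-uniform : ∀ z → Bounds.uniform (cl z) ≡ true → 360 + Bounds.share (cl z) * deg z ≤ 60 * deg z → Solvent z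
  solvent-uniform z ev enough = begin
      360 + ∑S                                        ≤⟨ +-monoʳ-≤ 360 ∑S≤ ⟩
      360 + b * deg z                                 ≤⟨ enough ⟩
      60 * deg z                                      ≤⟨ m≤m+n _ _ ⟩
      60 * deg z + 30 * nontriAt z                    ≤⟨ m≤m+n _ _ ⟩
      60 * deg z + 30 * nontriAt z + ∑ (rot z) (λ u → refund z u) ∎
    where
    open ≤-Reasoning
    b = Bounds.share (cl z)
    ∑S = ∑ (rot z) (S z)
    -- With `k = 2 * b` and `h = b`, what the neighbours of degree at least 6 save is exactly what
    -- they pass to their sides.
    open Around z (λ q → 2 * S z q) (λ _ → 0) (λ _ → 0) (λ _ → 0) (2 * b) (2 * b) b
    cancel : ∀ s b d k o → o ≡ 0 → 2 * s + 2 * b * k + (o + o) ≤ 2 * b * d + b * (k + k) + o → s ≤ b * d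
    cancel s b d k o refl le = *-cancelˡ-≤ 2 (+-cancelʳ-≤ (2 * b * k) (2 * s) (2 * (b * d))
      (subst₂ _≤_ (+-identityʳ _) (arith b d k) le))
      where
      arith : ∀ b d k → 2 * b * d + b * (k + k) + 0 ≡ 2 * (b * d) + 2 * b * k
      arith = solve-∀
    ∑S≤ : ∑S ≤ b * deg z
    ∑S≤ = cancel ∑S b (deg z) (K z) (∑ (rot z) (λ _ → 0)) (∑-zero z)
      (subst (λ s → s + 2 * b * K z + (∑ (rot z) (λ _ → 0) + ∑ (rot z) (λ _ → 0))
          ≤ 2 * b * deg z + b * (K z + K z) + ∑ (rot z) (λ _ → 0))
        (∑-* (rot z) 2 (S z)) (total (uniform-local ev)))

  odd-length : ∀ j k → k + k ≢ suc (j + j)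
  odd-length zero (suc zero) ()
  odd-length zero (suc (suc k)) ()
  odd-length (suc j) (suc k) eq = odd-length j k (suc-injective (suc-injective
    (trans (cong suc (sym (+-suc k k))) (trans eq (cong (2 +_) (+-suc j j))))))

  -- If deg z = 11, then 30 per neighbour is too much by 30.
  solvent-11 : ∀ z → cl z ≡ 11° → deg z ≡ 11 → Solvent z
  solvent-11 z eleven d≡ = enough (nontriAt z) refl (K z) refl
    where
    open ≤-Reasoning
    ∑S = ∑ (rot z) (S z)
    ∑0 = ∑ (rot z) (λ _ → 0)
    -- 300 = 60·11 - 360 is the initial charge of z.
    solvent : ∀ t → nontriAt z ≡ t → ∑S ≤ 300 + 30 * t → Solvent z
    solvent t refl le = begin
        360 + ∑S                          ≤⟨ +-monoʳ-≤ 360 le ⟩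
        660 + 30 * t                      ≡⟨ cong (λ d → 60 * d + 30 * t) (sym d≡) ⟩
        60 * deg z + 30 * t               ≤⟨ m≤m+n _ _ ⟩
        60 * deg z + 30 * t + ∑ (rot z) (λ u → refund z u) ∎
    -- Two neighbours of degree at least 6 save 36, enough for the excess 30; so does one
    -- non-triangular corner at z.
    crude : ∑S + 18 * K z ≤ 330
    crude = drop ∑S (K z) (deg z) ∑0 d≡ (∑-zero z) (total (11-local eleven))
      where
      open Around z (S z) (λ _ → 0) (λ _ → 0) (λ _ → 0) 30 30 6
      drop : ∀ s k d o → d ≡ 11 → o ≡ 0 → s + 30 * k + (o + o) ≤ 30 * d + 6 * (k + k) + o → s + 18 * k ≤ 330
      drop s k _ _ refl refl le = +-cancelʳ-≤ (12 * k) _ _ (subst₂ _≤_ (left s k) (right k) le)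
        where
        left : ∀ s k → s + 30 * k + 0 ≡ s + 18 * k + 12 * k
        left = solve-∀
        right : ∀ k → 330 + 6 * (k + k) + 0 ≡ 330 + 12 * k
        right = solve-∀
    -- Here `h = 0`: the charges of tight vertices cancel in the sum, and a single neighbour of
    -- degree at least 6 saves its full 30.
    fine : K z ≤ 1 → ∑S + 30 * K z ≤ 330
    fine K≤1 = drop ∑S (K z) (deg z) (∑ (rot z) i) (∑ (rot z) j) d≡ (∑-+ (rot z) j i)
        (total (tight-local eleven (≤-trans (m≤m+n 4 1) (5≤deg z)) K≤1))
      where
      i j : W → ℕ
      i q = 6 * ⟦ τ⁻ z q ⟧
      j q = 6 * ⟦ τ⁺ z q ⟧
      open Around z (S z) (λ q → j q + i q) i j 30 30 0
      drop : ∀ s k d a b {o} → d ≡ 11 → o ≡ b + a → s + 30 * k + (a + b) ≤ 30 * d + 0 * (k + k) + o → s + 30 * k ≤ 330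
      drop s k _ a b refl refl le = +-cancelʳ-≤ (a + b) _ _ (≤-trans le (≤-reflexive (cong (330 +_) (+-comm b a))))
    none : nontriAt z ≡ 0 → K z ≡ 0 → ∑S ≤ 300
    none t≡0 K≡0 with (p , p∈ , t) ← NoBig.parity {z} t≡0 K≡0 (λ k eq → odd-length 5 k (trans eq d≡)) = conclude (N.S-thrifty (cong parityClass eleven) p∈ t)
      where
      module N = NoBig {z} t≡0 K≡0
      each : ∀ {p} → p ∈ rot z → S z (nx z p) ≤ 30
      each {p} p∈ = only (S z (nx z p)) (N.E≡0 (nx-∈ p∈)) (N.E≡0 p∈) (N.E≡0 (nx-∈ (nx-∈ p∈))) (11-local eleven p∈)
        where
        only : ∀ s {a b c} → a ≡ 0 → b ≡ 0 → c ≡ 0 → s + 30 * a + (0 + 0) ≤ 30 + 6 * (b + c) + 0 → s ≤ 30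
        only s refl refl refl le = subst (_≤ 30) (trans (+-identityʳ _) (+-identityʳ s)) le
      finish : ∑ (rot z) (λ p → S z (nx z p)) + 30 ≤ ∑ (rot z) (λ _ → 30) → ∑S ≤ 300
      finish le = +-cancelʳ-≤ 30 ∑S 300 (subst₂ _≤_ (cong (_+ 30) (∑-next (noDup z) (S z)))
        (trans (∑-const (rot z) 30) (cong (30 *_) d≡)) le)
      conclude : S z (nx z p) ≡ 0 ⊎ S z (nx z p) ≤ 15 × S z (nx z (nx z p)) ≤ 15 → ∑S ≤ 300
      conclude (inj₁ s≡0) = finish (∑-gain 30 each p∈ (≤-reflexive (cong (30 +_) s≡0)))
      conclude (inj₂ (s≤15 , s′≤15)) = finish (∑-gain₂ 15 each p∈ (nx-∈ p∈)
        (λ p≡ → nextIn≢ (noDup z) p∈ (≤-trans (m≤m+n 2 3) (5≤deg z)) (sym p≡)) (+-monoʳ-≤ 15 s≤15) (+-monoʳ-≤ 15 s′≤15))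
    enough : ∀ t → nontriAt z ≡ t → ∀ k → K z ≡ k → Solvent z
    enough (suc t) eq k _ = solvent (suc t) eq (≤-trans (m+n≤o⇒m≤o ∑S crude)
      (+-monoʳ-≤ 300 (*-monoʳ-≤ 30 (s≤s (z≤n {t})))))
    enough zero eq zero k≡ = solvent 0 eq (none eq k≡)
    enough zero eq (suc zero) k≡ = solvent 0 eq (+-cancelʳ-≤ 30 ∑S 300
      (subst (λ k → ∑S + 30 * k ≤ 330) k≡ (fine (≤-reflexive k≡))))
    enough zero eq (suc (suc k)) k≡ = solvent 0 eq (+-cancelʳ-≤ 36 ∑S 300 (≤-trans (+-monoʳ-≤ ∑S (*-monoʳ-≤ 18 (s≤s (s≤s (z≤n {k})))))
      (≤-trans (subst (λ k → ∑S + 18 * k ≤ 330) k≡ crude) (m≤m+n 330 6))))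

  solvent-13 : ∀ z → cl z ≡ 13-17° → 13 ≤ deg z → Solvent z
  solvent-13 z class 13≤ = solvent
    where
    open ≤-Reasoning
    ∑S = ∑ (rot z) (S z)
    ∑refund = ∑ (rot z) (λ u → refund z u)
    t = nontriAt z
    i j : W → ℕ
    i q = 6 * ⟦ u⁻ z q ⟧
    j q = 6 * ⟦ u⁺ z q ⟧
    I = ∑ (rot z) i
    J = ∑ (rot z) j
    ∑x : ∑ (rot z) (λ q → 2 * S z q) ≡ 2 * ∑S
    ∑x = ∑-* (rot z) 2 (S z)
    ∑spare : ∑ (rot z) (spare z) ≡ (I + J) + 2 * ∑refund
    ∑spare = trans (∑-+ (rot z) (λ q → i q + j q) (λ q → 2 * refund z q))
      (cong₂ _+_ (∑-+ (rot z) i j) (∑-* (rot z) 2 (λ u → refund z u)))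

    cancel : ∀ h c {x ω} → x ≡ 2 * ∑S → ω ≡ (I + J) + 2 * ∑refund →
      x + 66 * K z + (I + J) + c ≤ 66 * deg z + h * (K z + K z) + ω →
      2 * ∑S + 66 * K z + c ≤ 66 * deg z + 2 * h * K z + 2 * ∑refund
    cancel h c refl refl le = +-cancelʳ-≤ (I + J) _ _
      (subst₂ _≤_ (left (2 * ∑S) (66 * K z) (I + J) c) (right (66 * deg z) h (K z) (I + J) (2 * ∑refund)) le)
      where
      left : ∀ s k a c → s + k + a + c ≡ s + k + c + a
      left = solve-∀
      right : ∀ d h k a r → d + h * (k + k) + (a + r) ≡ d + 2 * h * k + r + a
      right = solve-∀

    module At (two : Bool) = Around z (λ q → 2 * S z q) (spare z) i j 66 66 (Bounds.perSide two)

    generic : ∀ two → (two ≡ false → K z ≤ 1) →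
      2 * ∑S + 66 * K z + 0 ≤ 66 * deg z + 2 * Bounds.perSide two * K z + 2 * ∑refund
    generic two oneBig = cancel (Bounds.perSide two) 0 ∑x ∑spare
      (≤-trans (≤-reflexive (+-identityʳ _)) (At.total two (special-local two class oneBig)))

    parity-gain : deg z ≡ 13 → nontriAt z ≡ 0 → K z ≡ 0 →
      2 * ∑S + 66 * K z + 18 ≤ 66 * deg z + 2 * 27 * K z + 2 * ∑refund
    parity-gain d≡ t≡0 K≡0 with (p , p∈ , th) ← NoBig.parity {z} t≡0 K≡0 (λ k eq → odd-length 6 k (trans eq d≡)) =
        cancel 27 18 ∑x ∑spare (At.total-gain true 18 (special-local true class (λ ())) p∈
          (gap (S z (nx z p)) ⟦ u⁻ z (nx z (nx z p)) ⟧ ⟦ u⁺ z p ⟧ (27 * (E p + E (nx z (nx z p)))) (spare z (nx z p)) (N.E≡0 (nx-∈ p∈)) (low (N.S-thrifty (cong parityClass class) p∈ th))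
            (⟦⟧≤1 (u⁻ z (nx z (nx z p)))) (⟦⟧≤1 (u⁺ z p))))
      where
      module N = NoBig {z} t≡0 K≡0
      ⟦⟧≤1 : ∀ b → ⟦ b ⟧ ≤ 1
      ⟦⟧≤1 true = ≤-refl
      ⟦⟧≤1 false = z≤n
      low : S z (nx z p) ≡ 0 ⊎ S z (nx z p) ≤ 15 × S z (nx z (nx z p)) ≤ 15 → S z (nx z p) ≤ 15
      low (inj₁ s≡0) = ≤-trans (≤-reflexive s≡0) z≤n
      low (inj₂ (s≤15 , _)) = s≤15
      -- Even a thrifty neighbour charged from both sides leaves 18, which is twice the excess 9: 18
      -- + 2·15 + 12 = 60 ≤ 66.
      gap : ∀ s a b g ω {e} → e ≡ 0 → s ≤ 15 → a ≤ 1 → b ≤ 1 → 18 + (2 * s + 66 * e + (6 * a + 6 * b)) ≤ 66 + g + ω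
      gap s a b g ω refl s≤ a≤ b≤ = ≤-trans (+-monoʳ-≤ 18 (+-mono-≤ (+-monoˡ-≤ 0 (*-monoʳ-≤ 2 s≤))
        (+-mono-≤ (*-monoʳ-≤ 6 a≤) (*-monoʳ-≤ 6 b≤)))) (≤-trans (m≤m+n 60 (6 + g)) (m≤m+n (66 + g) ω))

    halve : 720 + 2 * ∑S ≤ 120 * deg z + 60 * t + 2 * ∑refund → Solvent z
    halve le = *-cancelˡ-≤ 2 (subst₂ _≤_ (left ∑S) (right (deg z) t ∑refund) le)
      where
      left : ∀ s → 720 + 2 * s ≡ 2 * (360 + s)
      left = solve-∀
      right : ∀ d t r → 120 * d + 60 * t + 2 * r ≡ 2 * (60 * d + 30 * t + r)
      right = solve-∀

    -- If deg z = 13, then 33 per neighbour is too much by 9.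
    saving : ∀ c → 2 * ∑S + c ≤ 66 * deg z + 2 * ∑refund → 720 + 66 * deg z ≤ 120 * deg z + 60 * t + c → Solvent z
    saving c le room = halve (+-cancelʳ-≤ c _ _ (begin
        720 + 2 * ∑S + c                              ≡⟨ +-assoc 720 (2 * ∑S) c ⟩
        720 + (2 * ∑S + c)                            ≤⟨ +-monoʳ-≤ 720 le ⟩
        720 + (66 * deg z + 2 * ∑refund)              ≡⟨ sym (+-assoc 720 (66 * deg z) (2 * ∑refund)) ⟩
        720 + 66 * deg z + 2 * ∑refund                ≤⟨ +-monoˡ-≤ (2 * ∑refund) room ⟩
        120 * deg z + 60 * t + c + 2 * ∑refund        ≡⟨ swap (120 * deg z + 60 * t) c (2 * ∑refund) ⟩
        120 * deg z + 60 * t + 2 * ∑refund + c        ∎))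
      where
      swap : ∀ a b c → a + b + c ≡ a + c + b
      swap = solve-∀

    -- Each neighbour of degree at least 6 saves 66 - 2·27 = 12, so two of them cover 18; a lone one
    -- saves 66 - 2·20 = 26 in `one-sided`.
    two-sided : 2 * ∑S + 12 * K z ≤ 66 * deg z + 2 * ∑refund
    two-sided = +-cancelʳ-≤ (54 * K z) _ _ (subst₂ _≤_ (left (2 * ∑S) (K z)) (right (66 * deg z) (K z) (2 * ∑refund))
      (generic true (λ ())))
      where
      left : ∀ s k → s + 66 * k + 0 ≡ s + 12 * k + 54 * k
      left = solve-∀
      right : ∀ d k r → d + 54 * k + r ≡ d + r + 54 * k
      right = solve-∀

    one-sided : K z ≡ 1 → 2 * ∑S + 26 ≤ 66 * deg z + 2 * ∑refund
    one-sided K≡1 = +-cancelʳ-≤ 40 _ _ (subst₂ _≤_ (trans (cong (λ k → 2 * ∑S + 66 * k + 0) K≡1) (left (2 * ∑S)))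
      (trans (cong (λ k → 66 * deg z + 40 * k + 2 * ∑refund) K≡1) (right (66 * deg z) (2 * ∑refund)))
      (generic false (λ _ → ≤-reflexive K≡1)))
      where
      left : ∀ s → s + 66 + 0 ≡ s + 26 + 40
      left = solve-∀
      right : ∀ d r → d + 40 + r ≡ d + r + 40
      right = solve-∀

    alternating : deg z ≡ 13 → nontriAt z ≡ 0 → K z ≡ 0 → 2 * ∑S + 18 ≤ 66 * deg z + 2 * ∑refund
    alternating d≡ t≡0 K≡0 = subst₂ _≤_
      (trans (cong (λ k → 2 * ∑S + 66 * k + 18) K≡0) (cong (_+ 18) (+-identityʳ (2 * ∑S))))
      (trans (cong (λ k → 66 * deg z + 54 * k + 2 * ∑refund) K≡0) (cong (_+ 2 * ∑refund) (+-identityʳ (66 * deg z))))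
      (parity-gain d≡ t≡0 K≡0)

    room13 : ∀ s c {d} → d ≡ 13 → 18 ≤ 60 * s + c → 720 + 66 * d ≤ 120 * d + 60 * s + c
    room13 s c refl le = ≤-trans (+-monoʳ-≤ 1560 le) (≤-reflexive (sym (+-assoc 1560 (60 * s) c)))

    exact : deg z ≡ 13 → ∀ t → nontriAt z ≡ t → ∀ k → K z ≡ k → Solvent z
    exact d≡ (suc s) t≡ k _ = saving (12 * K z) two-sided (room13 t (12 * K z) d≡
      (≤-trans (m≤m+n 18 42) (≤-trans (≤-trans (*-monoʳ-≤ 60 (s≤s (z≤n {s}))) (≤-reflexive (cong (60 *_) (sym t≡)))) (m≤m+n (60 * t) (12 * K z)))))
    exact d≡ zero t≡ zero k≡ = saving 18 (alternating d≡ t≡ k≡) (room13 t 18 d≡ (m≤n+m 18 (60 * t)))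
    exact d≡ zero t≡ (suc zero) k≡ = saving 26 (one-sided k≡) (room13 t 26 d≡ (≤-trans (m≤m+n 18 8) (m≤n+m 26 (60 * t))))
    exact d≡ zero t≡ (suc (suc k)) k≡ = saving (12 * K z) two-sided (room13 t (12 * K z) d≡
      (≤-trans (≤-trans (m≤m+n 18 6) (≤-trans (*-monoʳ-≤ 12 (s≤s (s≤s (z≤n {k})))) (≤-reflexive (cong (12 *_) (sym k≡))))) (m≤n+m (12 * K z) (60 * t))))

    solvent : Solvent z
    solvent with deg z ≟ 13
    ... | yes d≡ = exact d≡ t refl (K z) refl
    ... | no d≢ = saving (12 * K z) two-sided (≤-trans room (m≤m+n _ (12 * K z)))
      where
      room : 720 + 66 * deg z ≤ 120 * deg z + 60 * t
      room = begin
          -- From degree 14 on the rate 33 is affordable outright: 54·14 = 756 = 720 + 36.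
          720 + 66 * deg z             ≤⟨ +-monoˡ-≤ (66 * deg z) (≤-trans (m≤m+n 720 36) (*-monoʳ-≤ 54 (≤∧≢⇒< 13≤ (d≢ ∘ sym)))) ⟩
          54 * deg z + 66 * deg z      ≡⟨ sym (*-distribʳ-+ (deg z) 54 66) ⟩
          120 * deg z                  ≤⟨ m≤m+n _ _ ⟩
          120 * deg z + 60 * t         ∎

  -- The total charge against Euler's formula

  balanced : ∀ v → Balanced v
  balanced v = byClass refl refl (cl-correct v)
    where
    evenly : ∀ {c d} → cl v ≡ c → deg v ≡ d → major c ≡ true → Bounds.uniform c ≡ true →
      360 + Bounds.share c * d ≤ 60 * d → Balanced v
    evenly refl refl majorv ev enough = solvent⇒balanced v majorv (solvent-uniform v ev enough)
    byClass : ∀ {c d} → cl v ≡ c → deg v ≡ d → InClass c d → Balanced v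
    byClass eq _ in5 = balanced-5 v eq
    byClass eq _ in6 = balanced-6 v eq
    byClass eq d≡ in9 = evenly eq d≡ refl refl (m≤m+n 540 0)
    byClass eq d≡ in10 = evenly eq d≡ refl refl (m≤m+n 600 0)
    byClass eq d≡ in11 = solvent⇒balanced v (cong major eq) (solvent-11 v eq d≡)
    byClass eq d≡ in12 = evenly eq d≡ refl refl (m≤m+n 720 0)
    byClass eq d≡ (in13-17 13≤ _) = solvent⇒balanced v (cong major eq)
      (solvent-13 v eq (subst (13 ≤_) (sym d≡) 13≤))
    byClass {d = d} eq d≡ (in18+ 18≤) = evenly eq d≡ refl refl
      (≤-trans (+-monoˡ-≤ (40 * d) (*-monoʳ-≤ 20 18≤)) (≤-reflexive (sym (*-distribʳ-+ d 20 40))))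

  -- By `handshake` the total sent equals the total received, so `Φ` cancels and only the initial
  -- charges remain.
  absurd : ⊥
  absurd = <⇒≱ (*-monoʳ-< 30 euler-bound) (scale (suc n) (∑ V deg) (∑ V nontriAt) Φ charged (begin
      ∑ V (λ _ → 360) + Φ
        ≡⟨ sym (∑-+ V (λ _ → 360) (λ v → ∑ (rot v) (flow v))) ⟩
      ∑ V (λ v → 360 + ∑ (rot v) (flow v))
        ≤⟨ ∑-mono V (λ {v} _ → balanced v) ⟩
      ∑ V (λ v → 60 * deg v + 30 * nontriAt v + ∑ (rot v) (λ u → flow u v))
        ≡⟨ ∑-+ V (λ v → 60 * deg v + 30 * nontriAt v) (λ v → ∑ (rot v) (λ u → flow u v)) ⟩
      ∑ V (λ v → 60 * deg v + 30 * nontriAt v) + ∑ V (λ v → ∑ (rot v) (λ u → flow u v))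
        ≡⟨ cong₂ _+_ (∑-+ V (λ v → 60 * deg v) (λ v → 30 * nontriAt v)) (sym (handshake flow)) ⟩
      ∑ V (λ v → 60 * deg v) + ∑ V (λ v → 30 * nontriAt v) + Φ
        ≡⟨ cong₂ (λ d t → d + t + Φ) (∑-* V 60 deg) (∑-* V 30 nontriAt) ⟩
      60 * ∑ V deg + 30 * ∑ V nontriAt + Φ ∎))
    where
    open ≤-Reasoning
    Φ = ∑ V (λ v → ∑ (rot v) (flow v))
    charged : ∑ V (λ _ → 360) ≡ 360 * suc n
    charged = trans (∑-const V 360) (cong (360 *_) (length-toList (allFin (suc n))))
    scale : ∀ m d t φ {k} → k ≡ 360 * m → k + φ ≤ 60 * d + 30 * t + φ → 30 * (12 * m) ≤ 30 * (2 * d + t)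
    scale m d t φ refl le = subst₂ _≤_ (*-assoc 30 12 m) (factor d t) (+-cancelʳ-≤ φ _ _ le)
      where
      factor : ∀ d t → 60 * d + 30 * t ≡ 30 * (2 * d + t)
      factor = solve-∀

-- Decidability of stars

_≤∞?_ : ∀ d k → Dec (d ≤∞ k)
d ≤∞? nothing = yes _
d ≤∞? just k = d ≤? k

-- Discharging only refutes the absence of all stars; decidability turns this into a star. The
-- centre determines the other five witnesses, so the search runs over centres only.
hasStar? : ∀ {n} (G : PlaneGraph n) k₁ k₂ k₃ k₄ k₅ → Dec (HasStar G k₁ k₂ k₃ k₄ k₅)
hasStar? {n} G k₁ k₂ k₃ k₄ k₅ = Fin.any? decide
  where
  open PlaneGraph G
  Centred : Fin n → Set
  Centred v = Σ (Fin n) λ a → Σ (Fin n) λ b → Σ (Fin n) λ c → Σ (Fin n) λ d → Σ (Fin n) λ e →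
    (rot v ≡ a ∷ b ∷ c ∷ d ∷ e ∷ []) × Any (λ { (v₁ , v₂ , v₃ , v₄ , v₅) →
      (deg v₁ ≤∞ k₁) × (deg v₂ ≤∞ k₂) × (deg v₃ ≤∞ k₃) × (deg v₄ ≤∞ k₄) × (deg v₅ ≤∞ k₅) }) (dihedral5 a b c d e)
  centredAt : ∀ v xs → rot v ≡ xs → length xs ≡ 5 → Dec (Centred v)
  centredAt v (a ∷ b ∷ c ∷ d ∷ e ∷ []) eq _ = map′ (λ p → a , b , c , d , e , eq , p) unique (Any.any?
      (λ { (v₁ , v₂ , v₃ , v₄ , v₅) → (deg v₁ ≤∞? k₁) ×-dec (deg v₂ ≤∞? k₂) ×-dec (deg v₃ ≤∞? k₃)
             ×-dec (deg v₄ ≤∞? k₄) ×-dec (deg v₅ ≤∞? k₅) })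
      (dihedral5 a b c d e))
    where
    unique : Centred v → _
    unique (_ , _ , _ , _ , _ , eq′ , p) with refl ← trans (sym eq) eq′ = p
  decide : ∀ v → Dec (Centred v)
  decide v with deg v ≟ 5
  ... | yes five = centredAt v (rot v) refl five
  ... | no ≢5 = no (λ (_ , _ , _ , _ , _ , eq , _) → ≢5 (cong length eq))

theorem8 : (n : ℕ) (G : PlaneGraph (suc n)) →
    (∀ v → 5 ≤ PlaneGraph.deg G v) →
    (∀ v → PlaneGraph.deg G v ≢ 7) →
    (∀ v → PlaneGraph.deg G v ≢ 8) →
    HasStar G (just 5) (just 6) (just 6) (just 5) nothing
    ⊎ HasStar G (just 5) (just 6) (just 6) (just 6) (just 17)
    ⊎ HasStar G (just 6) (just 6) (just 6) (just 6) (just 11)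
    ⊎ HasStar G (just 5) (just 6) (just 9) (just 5) (just 10)
    ⊎ HasStar G (just 5) (just 6) (just 11) (just 5) (just 9)
    ⊎ HasStar G (just 5) (just 5) (just 10) (just 5) (just 12)
    ⊎ HasStar G (just 5) (just 5) (just 9) (just 5) (just 17)
theorem8 n G 5≤deg ≢7 ≢8 = decidable-stable
  (hasStar? G _ _ _ _ _ ⊎-dec hasStar? G _ _ _ _ _ ⊎-dec hasStar? G _ _ _ _ _ ⊎-dec hasStar? G _ _ _ _ _
    ⊎-dec hasStar? G _ _ _ _ _ ⊎-dec hasStar? G _ _ _ _ _ ⊎-dec hasStar? G _ _ _ _ _)
  (Discharging.absurd G 5≤deg ≢7 ≢8)
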